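{- Call an unordered pair of graphs $\{H_1,H_2\}$ settled if, for some ordering $(H_1,H_2)$ of the pair, one of the following holds: (a1) $H_1\subseteq_i P_4$ or $H_2\subseteq_i P_4$; (a2) $H_1=sP_1$ and $H_2=K_t$ for some positive integers $s,t$; (a3) $H_1\subseteq_i P_1+P_3$ and $\overline{H_2}\subseteq_i K_{1,3}+3P_1$, $K_{1,3}+P_2$, $P_1+S_{1,1,2}$, $P_6$ or $S_{1,1,3}$; (a4) $H_1\subseteq_i 2P_1+P_2$ and $\overline{H_2}\subseteq_i 2P_1+P_3$, $3P_1+P_2$ or $P_2+P_3$; (a5) $H_1\subseteq_i P_1+P_4$ and $\overline{H_2}\subseteq_i P_1+P_4$ or $P_5$; (a6) $H_1\subseteq_i 4P_1$ and $\overline{H_2}\subseteq_i 2P_1+P_3$; (a7) $H_1\subseteq_i K_{1,3}$ and $\overline{H_2}\subseteq_i K_{1,3}$; (b1) $H_1\notin\mathcal{S}$ and $H_2\notin\mathcal{S}$; (b2) $\overline{H_1}\notin\mathcal{S}$ and $\overline{H_2}\notin\mathcal{S}$; (b3) $H_1\supseteq_i K_{1,3}$ or $H_1\supseteq_i 2P_2$, and $\overline{H_2}\supseteq_i 4P_1$ or $\overline{H_2}\supseteq_i 2P_2$; (b4) $H_1\supseteq_i P_1+P_4$ and $\overline{H_2}\supseteq_i P_2+P_4$; (b5) $H_1\supseteq_i 2P_1+P_2$ and $\overline{H_2}\supseteq_i K_{1,3}$, $5P_1$, $P_2+P_4$ or $P_6$; (b6) $H_1\supseteq_i 3P_1$ and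 $\overline{H_2}\supseteq_i 2P_1+2P_2$, $2P_1+P_4$, $4P_1+P_2$, $3P_2$ or $2P_3$; (b7) $H_1\supseteq_i 4P_1$ and $\overline{H_2}\supseteq_i P_1+P_4$ or $3P_1+P_2$. Let $\mathcal{G}$ be a class of graphs defined by two forbidden induced subgraphs. Then $\mathcal{G}$ is not equivalent to the class of $(H_1,H_2)$-free graphs for any settled pair $\{H_1,H_2\}$ if and only if $\mathcal{G}$ is equivalent to the class of $(H_1,H_2)$-free graphs for one of the following 13 pairs: (1) $H_1=3P_1$ and $\overline{H_2}\in\{P_1+P_2+P_3,\ P_1+2P_2,\ P_1+P_5,\ P_1+S_{1,1,3},\ P_2+P_4,\ S_{1,2,2},\ S_{1,2,3}\}$; (2) $H_1=2P_1+P_2$ and $\overline{H_2}\in\{P_1+P_2+P_3,\ P_1+2P_2,\ P_1+P_5\}$; (3) $H_1=P_1+P_4$ and $\overline{H_2}\in\{P_1+2P_2,\ P_2+P_3\}$; (4) $H_1=\overline{H_2}=2P_1+P_3$.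
   Context: All graphs are finite, simple and undirected. $H\subseteq_i G$ (equivalently $G\supseteq_i H$) means $H$ is isomorphic to an induced subgraph of $G$; "$H\subseteq_i A$, $B$ or $C$" means $H$ is an induced subgraph of at least one of $A,B,C$, and similarly for $\supseteq_i$. A graph is $(H_1,H_2)$-free if it has no induced subgraph isomorphic to $H_1$ or $H_2$. $P_r$, $K_r$ denote the path and complete graph on $r$ vertices, $K_{1,3}$ is the claw; $G+H$ is disjoint union, $sG$ is the disjoint union of $s$ copies of $G$, $\overline{G}$ is the complement. For $1\le i\le j\le k$, $S_{i,j,k}$ is the tree with exactly one vertex $x$ of degree $3$ and exactly three leaves, at distances $i,j,k$ from $x$. $\mathcal{S}$ is the class of graphs each of whose connected components is either a path or some $S_{i,j,k}$. Two classes, of $(H_1,H_2)$-free graphs and of $(H_3,H_4)$-free graphs, are equivalent if the unordered pair $\{H_3,H_4\}$ can be obtained from the unordered pair $\{H_1,H_2\}$ by a sequence of the operations: (a) replacing both graphs by their complements; (b) if one graph of the pair is $K_3$, replacing it by $\overline{P_1+P_3}$, or vice versa. -}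

module Defs where

open import Data.Nat using (ℕ; zero; suc; _+_; _≡ᵇ_; _≤_)
open import Data.Bool using (Bool; true; false; not; _∧_; _∨_)
open import Data.Bool.Properties using (∨-comm)
open import Data.Fin using (Fin; toℕ; splitAt)
open import Data.Sum using (_⊎_; inj₁; inj₂)
open import Data.Product using (Σ; _×_; _,_; ∃)
open import Data.List using (List; []; _∷_)
open import Data.List.Relation.Unary.Any using (Any)
open import Relation.Nullary using (¬_)
open import Relation.Binary.PropositionalEquality using (_≡_; refl)
open import Relation.Binary.Construct.Closure.ReflexiveTransitive using (Star)
open import Function.Definitions using (Injective)

record Graph : Set where
  constructor graph
  field
    n     : ℕ
    adj   : Fin n → Fin n → Bool
    sym   : ∀ i j → adj i j ≡ adj j i
    irr   : ∀ i → adj i i ≡ false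
open Graph public

≡ᵇ-sym : ∀ m k → (m ≡ᵇ k) ≡ (k ≡ᵇ m)
≡ᵇ-sym zero zero = refl
≡ᵇ-sym zero (suc k) = refl
≡ᵇ-sym (suc m) zero = refl
≡ᵇ-sym (suc m) (suc k) = ≡ᵇ-sym m k

≡ᵇ-refl : ∀ m → (m ≡ᵇ m) ≡ true
≡ᵇ-refl zero = refl
≡ᵇ-refl (suc m) = ≡ᵇ-refl m

mk : (m : ℕ) → (Fin m → Fin m → Bool) → Graph
mk m r = graph m a s ir
  where
  a : Fin m → Fin m → Bool
  a i j = not (toℕ i ≡ᵇ toℕ j) ∧ (r i j ∨ r j i)
  s : ∀ i j → a i j ≡ a j i
  s i j rewrite ≡ᵇ-sym (toℕ i) (toℕ j) | ∨-comm (r i j) (r j i) = refl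
  ir : ∀ i → a i i ≡ false
  ir i rewrite ≡ᵇ-refl (toℕ i) = refl

_⊆i_ : Graph → Graph → Set
H ⊆i G = Σ (Fin (n H) → Fin (n G)) λ f →
  Injective _≡_ _≡_ f × (∀ i j → adj G (f i) (f j) ≡ adj H i j)

_⊆any_ : Graph → List Graph → Set
H ⊆any Gs = Any (H ⊆i_) Gs

_⊇any_ : Graph → List Graph → Set
G ⊇any Hs = Any (_⊆i G) Hs

_≅_ : Graph → Graph → Set
G ≅ H = Σ (Fin (n G) → Fin (n H)) λ f → Σ (Fin (n H) → Fin (n G)) λ g →
  (∀ i → g (f i) ≡ i) × (∀ j → f (g j) ≡ j) ×
  (∀ i j → adj H (f i) (f j) ≡ adj G i j)

co : Graph → Graph
co G = mk (n G) (λ i j → not (adj G i j))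

unionAdj : {p q : ℕ} → (Fin p → Fin p → Bool) → (Fin q → Fin q → Bool) →
           Fin p ⊎ Fin q → Fin p ⊎ Fin q → Bool
unionAdj a b (inj₁ i) (inj₁ j) = a i j
unionAdj a b (inj₂ i) (inj₂ j) = b i j
unionAdj a b (inj₁ i) (inj₂ j) = false
unionAdj a b (inj₂ i) (inj₁ j) = false

infixl 6 _⊕_
_⊕_ : Graph → Graph → Graph
G ⊕ H = mk (n G + n H)
  (λ i j → unionAdj (adj G) (adj H) (splitAt (n G) i) (splitAt (n G) j))

E : ℕ → Graph
E m = mk m (λ _ _ → false)

infix 7 _·_
_·_ : ℕ → Graph → Graph
zero · G = E 0
suc s · G = G ⊕ (s · G)

P : ℕ → Graph
P r = mk r (λ i j → suc (toℕ i) ≡ᵇ toℕ j)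

K : ℕ → Graph
K t = co (E t)

-- S_{i,j,k}: centre 0; legs 1..i, i+1..i+j, i+j+1..i+j+k
S : ℕ → ℕ → ℕ → Graph
S i j k = mk (suc (i + j + k)) (λ a b → rel (toℕ a) (toℕ b))
  where
  rel : ℕ → ℕ → Bool
  rel a b = ((suc a ≡ᵇ b) ∧ not (b ≡ᵇ suc i) ∧ not (b ≡ᵇ suc (i + j)))
          ∨ ((a ≡ᵇ 0) ∧ ((b ≡ᵇ suc i) ∨ (b ≡ᵇ suc (i + j))))

K13 : Graph
K13 = S 1 1 1

P1 P2 P3 P4 P5 P6 : Graph
P1 = P 1
P2 = P 2
P3 = P 3
P4 = P 4
P5 = P 5
P6 = P 6

data Component : Graph → Set where
  path   : ∀ r → 1 ≤ r → Component (P r)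
  spider : ∀ i j k → 1 ≤ i → i ≤ j → j ≤ k → Component (S i j k)

unionL : List Graph → Graph
unionL [] = E 0
unionL (G ∷ Gs) = G ⊕ unionL Gs

data AllComp : List Graph → Set where
  []  : AllComp []
  _∷_ : ∀ {G Gs} → Component G → AllComp Gs → AllComp (G ∷ Gs)

InS : Graph → Set
InS G = Σ (List Graph) λ Gs → AllComp Gs × (G ≅ unionL Gs)

SettledOrd : Graph → Graph → Set
SettledOrd H₁ H₂ =
    (H₁ ⊆i P4 ⊎ H₂ ⊆i P4)
  ⊎ (Σ ℕ λ s → Σ ℕ λ t → 1 ≤ s × 1 ≤ t × H₁ ≅ (s · P1) × H₂ ≅ K t)
  ⊎ (H₁ ⊆i (P1 ⊕ P3) ×
     co H₂ ⊆any (K13 ⊕ 3 · P1 ∷ K13 ⊕ P2 ∷ P1 ⊕ S 1 1 2 ∷ P6 ∷ S 1 1 3 ∷ []))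
  ⊎ (H₁ ⊆i (2 · P1 ⊕ P2) ×
     co H₂ ⊆any (2 · P1 ⊕ P3 ∷ 3 · P1 ⊕ P2 ∷ P2 ⊕ P3 ∷ []))
  ⊎ (H₁ ⊆i (P1 ⊕ P4) × co H₂ ⊆any (P1 ⊕ P4 ∷ P5 ∷ []))
  ⊎ (H₁ ⊆i (4 · P1) × co H₂ ⊆i (2 · P1 ⊕ P3))
  ⊎ (H₁ ⊆i K13 × co H₂ ⊆i K13)
  ⊎ (¬ InS H₁ × ¬ InS H₂)
  ⊎ (¬ InS (co H₁) × ¬ InS (co H₂))
  ⊎ ((K13 ⊆i H₁ ⊎ (2 · P2) ⊆i H₁) × ((4 · P1) ⊆i co H₂ ⊎ (2 · P2) ⊆i co H₂))
  ⊎ ((P1 ⊕ P4) ⊆i H₁ × (P2 ⊕ P4) ⊆i co H₂)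
  ⊎ ((2 · P1 ⊕ P2) ⊆i H₁ × co H₂ ⊇any (K13 ∷ 5 · P1 ∷ P2 ⊕ P4 ∷ P6 ∷ []))
  ⊎ ((3 · P1) ⊆i H₁ ×
     co H₂ ⊇any (2 · P1 ⊕ 2 · P2 ∷ 2 · P1 ⊕ P4 ∷ 4 · P1 ⊕ P2 ∷ 3 · P2 ∷ 2 · P3 ∷ []))
  ⊎ ((4 · P1) ⊆i H₁ × co H₂ ⊇any (P1 ⊕ P4 ∷ 3 · P1 ⊕ P2 ∷ []))

Settled : Graph → Graph → Set
Settled H₁ H₂ = SettledOrd H₁ H₂ ⊎ SettledOrd H₂ H₁

-- Equivalence of classes given by (unordered) pairs of forbidden graphs

data Step : Graph × Graph → Graph × Graph → Set where
  -- the pair is unordered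
  swap  : ∀ {A B} → Step (A , B) (B , A)
  -- graphs are taken up to isomorphism
  iso   : ∀ {A B C D} → A ≅ C → B ≅ D → Step (A , B) (C , D)
  compl : ∀ {A B} → Step (A , B) (co A , co B)
  K3→   : ∀ {B} → Step (K 3 , B) (co (P1 ⊕ P3) , B)
  →K3   : ∀ {B} → Step (co (P1 ⊕ P3) , B) (K 3 , B)

Equiv : Graph × Graph → Graph × Graph → Set
Equiv = Star Step

-- The 13 pairs, listed as (H₁ , complement of H₂)

thirteen : List (Graph × Graph)
thirteen =
    (3 · P1 , P1 ⊕ P2 ⊕ P3) ∷ (3 · P1 , P1 ⊕ 2 · P2) ∷ (3 · P1 , P1 ⊕ P5)
  ∷ (3 · P1 , P1 ⊕ S 1 1 3) ∷ (3 · P1 , P2 ⊕ P4) ∷ (3 · P1 , S 1 2 2)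
  ∷ (3 · P1 , S 1 2 3)
  ∷ (2 · P1 ⊕ P2 , P1 ⊕ P2 ⊕ P3) ∷ (2 · P1 ⊕ P2 , P1 ⊕ 2 · P2)
  ∷ (2 · P1 ⊕ P2 , P1 ⊕ P5)
  ∷ (P1 ⊕ P4 , P1 ⊕ 2 · P2) ∷ (P1 ⊕ P4 , P2 ⊕ P3)
  ∷ (2 · P1 ⊕ P3 , 2 · P1 ⊕ P3)
  ∷ []

EquivToThirteen : Graph → Graph → Set
EquivToThirteen H₁ H₂ =
  Any (λ p → Equiv (H₁ , H₂) (Data.Product.proj₁ p , co (Data.Product.proj₂ p))) thirteen

EquivToSettled : Graph → Graph → Set
EquivToSettled H₁ H₂ =
  Σ Graph λ H₃ → Σ Graph λ H₄ → Settled H₃ H₄ × Equiv (H₁ , H₂) (H₃ , H₄)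

{-# OPTIONS --safe #-}
-- Write A = H₁ and B = co H₂.  By (b1) and (b2) only pairs with A and B in the class S
-- matter, because a graph in S whose complement is also in S embeds into P₄.  Conditions
-- (a1), (a3)–(a7), (b3)–(b7) compare A and B with fixed small graphs.  A graph in S contains
-- one of the five graphs of (b6), or is sP₁ with s ≥ 5, or is one of 34 graphs on at most
-- seven vertices, so all that remains is a finite table, evaluated by a verified search for
-- induced embeddings.  Up to isomorphism the table leaves exactly 20 pairs unsettled: the
-- thirteen, and the seven in which 3P₁ is replaced by P₁ + P₃.  Being among these 20 is
-- invariant under equivalence and decidable; decidability is what makes the classical case
-- distinction on membership in S available.
module Submission where

open import Defs hiding (sym)
open import Data.Bool using (Bool; true; false; not; _∧_; _∨_; T; T?)
open import Data.Bool.Properties using (∧-zeroʳ; ∨-idem; not-involutive; T-≡; T-∧; T-∨)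
open import Data.Fin using (Fin; zero; suc; _≟_; toℕ; #_; inject≤; join; punchOut; splitAt; _↑ˡ_; _↑ʳ_)
open import Data.Fin.Patterns using (0F; 1F; 2F; 3F; 4F)
open import Data.Fin.Properties using (any?; inject≤-injective; injective⇒≤; join-splitAt; punchOut-injective; splitAt-↑ˡ; splitAt-↑ʳ; suc-injective; toℕ-inject≤; toℕ-injective; toℕ-↑ˡ; toℕ-↑ʳ; ↑ˡ-injective; ↑ʳ-injective)
open import Data.List as List using (List; []; _∷_; [_]; _++_; take)
open import Data.List.Membership.Propositional using (_∈_; lose)
open import Data.List.Membership.Propositional.Properties using (∈-lookup; ∈-++⁺ʳ)
open import Data.List.Relation.Unary.All as All using (All; []; _∷_)
open import Data.List.Relation.Unary.Any as Any using (Any; here; there)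
open import Data.List.Relation.Unary.Any.Properties using (Any-⊎⁺; Any-⊎⁻)
open import Data.Nat as ℕ using (ℕ; zero; suc; _+_; _≤_; _≤ᵇ_; _≡ᵇ_; z≤n; s≤s)
import Data.Nat.Properties as ℕ
open import Data.Product as Product using (Σ; ∃; _×_; _,_; proj₁; proj₂)
open import Data.Sum as Sum using (_⊎_; inj₁; inj₂)
open import Data.Sum.Properties using (inj₁-injective; inj₂-injective)
open import Data.Unit using (⊤; tt)
open import Data.Vec using (Vec; []; _∷_; lookup; replicate; tabulate)
open import Data.Vec.Properties using (lookup∘tabulate; lookup-replicate)
open import Function using (_∘_; id; Equivalence; mk⇔)
open import Function.Bundles using (_⇔_)
open import Function.Definitions using (Injective)
open import Relation.Binary.Construct.Closure.ReflexiveTransitive using (ε; _◅_; _◅◅_)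
open import Relation.Binary.PropositionalEquality hiding ([_])
open import Relation.Nullary using (¬_; Dec; yes; no; contradiction)
open import Relation.Nullary.Decidable using (True; decidable-stable; map′; toWitness; ¬?; _→-dec_; _×-dec_; _⊎-dec_)

-- Embeddings and isomorphisms

-- H ⊆i G and G ≅ H unfold to Σ-types from which Agda cannot infer the graphs.
record _↪_ (H G : Graph) : Set where
  constructor ↪⁺
  field ↪⁻ : H ⊆i G
open _↪_

record _≃_ (G H : Graph) : Set where
  constructor ≃⁺
  field ≃⁻ : G ≅ H
open _≃_

infix 4 _↪_ _≃_

↪-trans : ∀ {F G H} → F ↪ G → G ↪ H → F ↪ H
↪-trans (↪⁺ (f , f-inj , f-adj)) (↪⁺ (g , g-inj , g-adj)) =
  ↪⁺ (g ∘ f , f-inj ∘ g-inj , λ i j → trans (g-adj (f i) (f j)) (f-adj i j))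

≃-refl : ∀ {G} → G ≃ G
≃-refl = ≃⁺ (id , id , (λ _ → refl) , (λ _ → refl) , λ _ _ → refl)

≃-sym : ∀ {G H} → G ≃ H → H ≃ G
≃-sym {G} {H} (≃⁺ (f , g , gf , fg , f-adj)) = ≃⁺ (g , f , fg , gf ,
  λ i j → trans (sym (f-adj (g i) (g j))) (cong₂ (adj H) (fg i) (fg j)))

≃-trans : ∀ {F G H} → F ≃ G → G ≃ H → F ≃ H
≃-trans (≃⁺ (f , f⁻ , f⁻f , ff⁻ , f-adj)) (≃⁺ (g , g⁻ , g⁻g , gg⁻ , g-adj)) = ≃⁺
  ( g ∘ f , f⁻ ∘ g⁻
  , (λ i → trans (cong f⁻ (g⁻g (f i))) (f⁻f i))
  , (λ i → trans (cong g (ff⁻ (g⁻ i))) (gg⁻ i))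
  , λ i j → trans (g-adj (f i) (f j)) (f-adj i j))

≃⇒↪ : ∀ {G H} → G ≃ H → G ↪ H
≃⇒↪ (≃⁺ (f , g , gf , fg , f-adj)) =
  ↪⁺ (f , (λ {i} {j} e → trans (sym (gf i)) (trans (cong g e) (gf j))) , f-adj)

↪⇒≤ : ∀ {H G} → H ↪ G → n H ℕ.≤ n G
↪⇒≤ (↪⁺ (f , f-inj , _)) = injective⇒≤ f-inj

-- Pigeonhole: if `y` were missed, punching it out of the codomain would leave an injection into a
-- set with one element fewer.
injective⇒surjective : ∀ {m} (f : Fin m → Fin m) → Injective _≡_ _≡_ f → ∀ y → ∃ λ x → f x ≡ y
injective⇒surjective {suc m} f f-inj y with any? (λ x → f x ≟ y)
... | yes hit = hit
... | no miss = contradiction (injective⇒≤ avoid-inj) ℕ.1+n≰n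
  where
  y≢f : ∀ x → y ≢ f x
  y≢f x y≡fx = miss (x , sym y≡fx)
  avoid : Fin (suc m) → Fin m
  avoid x = punchOut (y≢f x)
  avoid-inj : Injective _≡_ _≡_ avoid
  avoid-inj {i} {j} e = f-inj (punchOut-injective (y≢f i) (y≢f j) e)

-- An injection between vertex sets of equal size is a bijection. This reduces constructing or
-- deciding an isomorphism to finding an embedding.
↪-sameSize⇒≃ : ∀ {G H} → n G ≡ n H → G ↪ H → G ≃ H
↪-sameSize⇒≃ {graph m _ _ _} {graph .m _ _ _} refl (↪⁺ (f , f-inj , f-adj)) =
  ≃⁺ (f , proj₁ ∘ hits , (λ i → f-inj (proj₂ (hits (f i)))) , proj₂ ∘ hits , f-adj)
  where hits = injective⇒surjective f f-inj

≃⇒sameSize : ∀ {G H} → G ≃ H → n G ≡ n H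
≃⇒sameSize G≃H = ℕ.≤-antisym (↪⇒≤ (≃⇒↪ G≃H)) (↪⇒≤ (≃⇒↪ (≃-sym G≃H)))

-- Complement and disjoint union

-- `mk` symmetrises a relation and clears its diagonal; a symmetric irreflexive relation is left
-- unchanged by both.
mk-adj : ∀ {m} (r : Fin m → Fin m → Bool) → (∀ i j → r i j ≡ r j i) → (∀ i → r i i ≡ false) →
  ∀ i j → adj (mk m r) i j ≡ r i j
mk-adj r r-sym r-irr i j with toℕ i ≡ᵇ toℕ j in eq
... | false = trans (cong (r i j ∨_) (r-sym j i)) (∨-idem (r i j))
... | true with refl ← toℕ-injective (ℕ.≡ᵇ⇒≡ (toℕ i) (toℕ j) (Equivalence.from T-≡ eq)) = sym (r-irr i)

co-adj : ∀ G {i j} → i ≢ j → adj (co G) i j ≡ not (adj G i j)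
co-adj G {i} {j} i≢j with toℕ i ≡ᵇ toℕ j in eq
... | false = trans (cong (λ b → not (adj G i j) ∨ not b) (Graph.sym G j i)) (∨-idem (not (adj G i j)))
... | true = contradiction (toℕ-injective (ℕ.≡ᵇ⇒≡ (toℕ i) (toℕ j) (Equivalence.from T-≡ eq))) i≢j

-- Irreflexivity of both graphs takes care of the diagonal. Restricting to distinct vertices matters
-- for complements, where adjacency is negated only off the diagonal.
embedding : ∀ {G H} (f : Fin (n G) → Fin (n H)) → Injective _≡_ _≡_ f →
  (∀ {i j} → i ≢ j → adj H (f i) (f j) ≡ adj G i j) → G ↪ H
embedding {G} {H} f f-inj f-adj = ↪⁺ (f , f-inj , pres)
  where
  pres : ∀ i j → adj H (f i) (f j) ≡ adj G i j
  pres i j with i ≟ j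
  ... | yes refl = trans (irr H (f i)) (sym (irr G i))
  ... | no i≢j   = f-adj i≢j

co-mono : ∀ {G H} → G ↪ H → co G ↪ co H
co-mono {G} {H} (↪⁺ (f , f-inj , f-adj)) = embedding f f-inj λ {i} {j} i≢j →
  trans (co-adj H (i≢j ∘ f-inj)) (trans (cong not (f-adj i j)) (sym (co-adj G i≢j)))

co-cong : ∀ {G H} → G ≃ H → co G ≃ co H
co-cong G≃H = ↪-sameSize⇒≃ (≃⇒sameSize G≃H) (co-mono (≃⇒↪ G≃H))

co-involutive : ∀ G → co (co G) ≃ G
co-involutive G = ↪-sameSize⇒≃ refl (embedding id id λ {i} {j} i≢j → sym
  (trans (co-adj (co G) i≢j) (trans (cong not (co-adj G i≢j)) (not-involutive (adj G i j)))))

co-flip : ∀ {G H} → co G ≃ H → G ≃ co H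
co-flip {G} coG≃H = ≃-trans (≃-sym (co-involutive G)) (co-cong coG≃H)

⊕-adj : ∀ G H i j →
  adj (G ⊕ H) i j ≡ unionAdj (adj G) (adj H) (splitAt (n G) i) (splitAt (n G) j)
⊕-adj G H = mk-adj _ (λ i j → u-sym (splitAt (n G) i) (splitAt (n G) j)) (λ i → u-irr (splitAt (n G) i))
  where
  u-sym : ∀ x y → unionAdj (adj G) (adj H) x y ≡ unionAdj (adj G) (adj H) y x
  u-sym (inj₁ i) (inj₁ j) = Graph.sym G i j
  u-sym (inj₁ i) (inj₂ j) = refl
  u-sym (inj₂ i) (inj₁ j) = refl
  u-sym (inj₂ i) (inj₂ j) = Graph.sym H i j
  u-irr : ∀ x → unionAdj (adj G) (adj H) x x ≡ false
  u-irr (inj₁ i) = irr G i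
  u-irr (inj₂ i) = irr H i

⊕-mono : ∀ {G H G′ H′} → G ↪ G′ → H ↪ H′ → (G ⊕ H) ↪ (G′ ⊕ H′)
⊕-mono {G} {H} {G′} {H′} (↪⁺ (f , f-inj , f-adj)) (↪⁺ (g , g-inj , g-adj)) =
  ↪⁺ (h ∘ splitAt (n G) , splitAt-inj ∘ h-inj , pres)
  where
  h : Fin (n G) ⊎ Fin (n H) → Fin (n G′ ℕ.+ n H′)
  h (inj₁ i) = f i ↑ˡ n H′
  h (inj₂ j) = n G′ ↑ʳ g j

  split-h : ∀ x → splitAt (n G′) (h x) ≡ Sum.map f g x
  split-h (inj₁ i) = splitAt-↑ˡ (n G′) (f i) (n H′)
  split-h (inj₂ j) = splitAt-↑ʳ (n G′) (n H′) (g j)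

  map-inj : ∀ x y → Sum.map f g x ≡ Sum.map f g y → x ≡ y
  map-inj (inj₁ i) (inj₁ j) e = cong inj₁ (f-inj (inj₁-injective e))
  map-inj (inj₂ i) (inj₂ j) e = cong inj₂ (g-inj (inj₂-injective e))

  h-inj : ∀ {x y} → h x ≡ h y → x ≡ y
  h-inj {x} {y} e = map-inj x y (trans (sym (split-h x)) (trans (cong (splitAt (n G′)) e) (split-h y)))

  splitAt-inj : ∀ {i j} → splitAt (n G) i ≡ splitAt (n G) j → i ≡ j
  splitAt-inj {i} {j} e = trans (sym (join-splitAt (n G) (n H) i))
    (trans (cong (join (n G) (n H)) e) (join-splitAt (n G) (n H) j))

  u-map : ∀ x y → unionAdj (adj G′) (adj H′) (Sum.map f g x) (Sum.map f g y) ≡ unionAdj (adj G) (adj H) x y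
  u-map (inj₁ i) (inj₁ j) = f-adj i j
  u-map (inj₁ i) (inj₂ j) = refl
  u-map (inj₂ i) (inj₁ j) = refl
  u-map (inj₂ i) (inj₂ j) = g-adj i j

  pres : ∀ i j → adj (G′ ⊕ H′) (h (splitAt (n G) i)) (h (splitAt (n G) j)) ≡ adj (G ⊕ H) i j
  pres i j = trans (⊕-adj G′ H′ _ _) (trans
    (cong₂ (unionAdj (adj G′) (adj H′)) (split-h (splitAt (n G) i)) (split-h (splitAt (n G) j)))
    (trans (u-map (splitAt (n G) i) (splitAt (n G) j)) (sym (⊕-adj G H i j))))

⊕-cong : ∀ {G H G′ H′} → G ≃ G′ → H ≃ H′ → (G ⊕ H) ≃ (G′ ⊕ H′)
⊕-cong G≃G′ H≃H′ = ↪-sameSize⇒≃ (cong₂ ℕ._+_ (≃⇒sameSize G≃G′) (≃⇒sameSize H≃H′))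
  (⊕-mono (≃⇒↪ G≃G′) (≃⇒↪ H≃H′))

⊕-⊇ʳ : ∀ G {H} → H ↪ (G ⊕ H)
⊕-⊇ʳ G {H} = ↪⁺ (n G ↑ʳ_ , ↑ʳ-injective (n G) _ _ , λ i j → trans (⊕-adj G H _ _)
  (cong₂ (unionAdj (adj G) (adj H)) (splitAt-↑ʳ (n G) (n H) i) (splitAt-↑ʳ (n G) (n H) j)))

⊕-⊇ˡ : ∀ {G} H → G ↪ (G ⊕ H)
⊕-⊇ˡ {G} H = ↪⁺ (_↑ˡ n H , ↑ˡ-injective (n H) _ _ , λ i j → trans (⊕-adj G H _ _)
  (cong₂ (unionAdj (adj G) (adj H)) (splitAt-↑ˡ (n G) i (n H)) (splitAt-↑ˡ (n G) j (n H))))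

-- Deciding ⊆i

Mask : ℕ → Set
Mask = Vec Bool

_∈ᵐ_ : ∀ {m} → Fin m → Mask m → Set
v ∈ᵐ c = T (lookup c v)

agree : Bool → Bool → Bool
agree true  b = b
agree false b = not b

agree⇒≡ : ∀ e b → T (agree e b) → b ≡ e
agree⇒≡ true  true  _ = refl
agree⇒≡ false false _ = refl

agree-refl : ∀ e → T (agree e e)
agree-refl true  = tt
agree-refl false = tt

keep : ∀ {m} → Bool → Vec Bool m → Mask m → Mask m
keep e []      []          = []
keep e (r ∷ R) (false ∷ c) = false ∷ keep e R c
keep e (r ∷ R) (true ∷ c)  = agree e r ∷ keep e R c

keep⁻ : ∀ {m} e (R : Vec Bool m) c w → w ∈ᵐ keep e R c → w ∈ᵐ c × lookup R w ≡ e
keep⁻ e (r ∷ R) (true ∷ c)  zero    w∈ = tt , agree⇒≡ e r w∈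
keep⁻ e (r ∷ R) (true ∷ c)  (suc w) w∈ = keep⁻ e R c w w∈
keep⁻ e (r ∷ R) (false ∷ c) (suc w) w∈ = keep⁻ e R c w w∈

keep⁺ : ∀ {m} e (R : Vec Bool m) c w → w ∈ᵐ c → lookup R w ≡ e → w ∈ᵐ keep e R c
keep⁺ e (r ∷ R) (true ∷ c)  zero    w∈ refl = agree-refl e
keep⁺ e (r ∷ R) (true ∷ c)  (suc w) w∈ eq   = keep⁺ e R c w w∈ eq
keep⁺ e (r ∷ R) (false ∷ c) (suc w) w∈ eq   = keep⁺ e R c w w∈ eq

clear : ∀ {m} → Fin m → Mask m → Mask m
clear zero    (x ∷ c) = false ∷ c
clear (suc v) (x ∷ c) = x ∷ clear v c

clear⁻ : ∀ {m} v (c : Mask m) w → w ∈ᵐ clear v c → v ≢ w × w ∈ᵐ c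
clear⁻ zero    (x ∷ c) (suc w) w∈ = (λ ()) , w∈
clear⁻ (suc v) (x ∷ c) zero    w∈ = (λ ()) , w∈
clear⁻ (suc v) (x ∷ c) (suc w) w∈ with v≢w , w∈c ← clear⁻ v c w w∈ = v≢w ∘ suc-injective , w∈c

clear⁺ : ∀ {m} v (c : Mask m) w → v ≢ w → w ∈ᵐ c → w ∈ᵐ clear v c
clear⁺ zero    (x ∷ c) zero    v≢w w∈ = contradiction refl v≢w
clear⁺ zero    (x ∷ c) (suc w) v≢w w∈ = w∈
clear⁺ (suc v) (x ∷ c) zero    v≢w w∈ = w∈
clear⁺ (suc v) (x ∷ c) (suc w) v≢w w∈ = clear⁺ v c w (v≢w ∘ cong suc) w∈

some : ∀ {m} → Mask m → (Fin m → Bool) → Bool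
some []          p = false
some (true ∷ c)  p = p zero ∨ some c (p ∘ suc)
some (false ∷ c) p = some c (p ∘ suc)

some⁻ : ∀ {m} (c : Mask m) p → T (some c p) → ∃ λ v → v ∈ᵐ c × T (p v)
some⁻ (false ∷ c) p t with v , v∈ , pv ← some⁻ c (p ∘ suc) t = suc v , v∈ , pv
some⁻ (true ∷ c)  p t with Equivalence.to T-∨ t
... | inj₁ p0 = zero , tt , p0
... | inj₂ t′ with v , v∈ , pv ← some⁻ c (p ∘ suc) t′ = suc v , v∈ , pv

some⁺ : ∀ {m} (c : Mask m) p v → v ∈ᵐ c → T (p v) → T (some c p)
some⁺ (true ∷ c)  p zero    v∈ pv = Equivalence.from T-∨ (inj₁ pv)
some⁺ (true ∷ c)  p (suc v) v∈ pv = Equivalence.from T-∨ (inj₂ (some⁺ c (p ∘ suc) v v∈ pv))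
some⁺ (false ∷ c) p (suc v) v∈ pv = some⁺ c (p ∘ suc) v v∈ pv

restrict : ∀ {m k} → Fin m → Vec Bool m → Vec Bool k → Vec (Mask m) k → Vec (Mask m) k
restrict v R []      []      = []
restrict v R (e ∷ r) (c ∷ C) = clear v (keep e R c) ∷ restrict v R r C

lookup-restrict : ∀ {m k} v (R : Vec Bool m) r (C : Vec (Mask m) k) i →
  lookup (restrict v R r C) i ≡ clear v (keep (lookup r i) R (lookup C i))
lookup-restrict v R (e ∷ r) (c ∷ C) zero    = refl
lookup-restrict v R (e ∷ r) (c ∷ C) (suc i) = lookup-restrict v R r C i

-- The row of a vertex holds only its adjacencies to later vertices: these are the vertices still to
-- be constrained when its image is chosen.
data Triangle : ℕ → Set where
  []  : Triangle zero
  _∷_ : ∀ {k} → Vec Bool k → Triangle k → Triangle (suc k)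

triangle : ∀ {k} → (Fin k → Fin k → Bool) → Triangle k
triangle {zero}  b = []
triangle {suc k} b = tabulate (b zero ∘ suc) ∷ triangle (λ i j → b (suc i) (suc j))

-- Backtracking with forward checking: the masks record the vertices that are still
-- admissible images, given the images chosen so far.  Both adjacency relations are
-- tabulated so that evaluation shares their entries.
search : ∀ {m k} → Vec (Vec Bool m) m → Triangle k → Vec (Mask m) k → Bool
search M []      []      = true
search M (r ∷ b) (c ∷ C) = some c λ v → search M b (restrict v (lookup M v) r C)

module _ {m} (M : Vec (Vec Bool m) m) (M-sym : ∀ v w → lookup (lookup M v) w ≡ lookup (lookup M w) v) where

  Fits : Fin m → Bool → Fin m → Set
  Fits v e w = v ≢ w × lookup (lookup M v) w ≡ e

  Solution : ∀ {k} → (Fin k → Fin k → Bool) → Vec (Mask m) k → (Fin k → Fin m) → Set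
  Solution b C f = (∀ i → f i ∈ᵐ lookup C i) × (∀ i j → i ≢ j → Fits (f i) (b i j) (f j))

  -- Pairs involving the first vertex fit because the masks of all later vertices were restricted by
  -- its image; the other pairs fit by induction, which requires arbitrary masks.
  search-sound : ∀ {k} (b : Fin k → Fin k → Bool) → (∀ i j → b i j ≡ b j i) → ∀ C →
    T (search M (triangle b) C) → ∃ (Solution b C)
  search-sound b b-sym [] _ = (λ ()) , (λ ()) , λ ()
  search-sound {suc k} b b-sym (c ∷ C) t
    with v , v∈c , t′ ← some⁻ c _ t
    with f , f∈ , f-fits ← search-sound _ (λ i j → b-sym (suc i) (suc j)) _ t′
    = g , g∈ , g-fits
    where
    R = lookup M v
    r = tabulate (b zero ∘ suc)

    fits : ∀ i → Fits v (b zero (suc i)) (f i) × f i ∈ᵐ lookup C i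
    fits i
      with v≢f , f∈k ← clear⁻ v (keep (lookup r i) R (lookup C i)) (f i)
             (subst (f i ∈ᵐ_) (lookup-restrict v R r C i) (f∈ i))
      with f∈C , e ← keep⁻ (lookup r i) R (lookup C i) (f i) f∈k
      = (v≢f , trans e (lookup∘tabulate (b zero ∘ suc) i)) , f∈C

    g : Fin (suc k) → Fin m
    g zero    = v
    g (suc i) = f i

    g∈ : ∀ i → g i ∈ᵐ lookup (c ∷ C) i
    g∈ zero    = v∈c
    g∈ (suc i) = proj₂ (fits i)

    g-fits : ∀ i j → i ≢ j → Fits (g i) (b i j) (g j)
    g-fits zero    zero    i≢j = contradiction refl i≢j
    g-fits zero    (suc j) i≢j = proj₁ (fits j)
    g-fits (suc i) zero    i≢j with (v≢f , e) , _ ← fits i =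
      v≢f ∘ sym , trans (M-sym (f i) v) (trans e (b-sym zero (suc i)))
    g-fits (suc i) (suc j) i≢j = f-fits i j (i≢j ∘ cong suc)

  -- The branch that follows `f` survives: restricting by `f zero` never removes the image of a
  -- later vertex, since `f` fits on that pair.
  search-complete : ∀ {k} (b : Fin k → Fin k → Bool) C f → Solution b C f → T (search M (triangle b) C)
  search-complete b []      f _           = tt
  search-complete b (c ∷ C) f (f∈ , fits) =
    some⁺ c _ (f zero) (f∈ zero)
      (search-complete _ _ (f ∘ suc) (f∈restrict , λ i j i≢j → fits _ _ (i≢j ∘ suc-injective)))
    where
    R = lookup M (f zero)
    r = tabulate (b zero ∘ suc)

    f∈restrict : ∀ i → f (suc i) ∈ᵐ lookup (restrict (f zero) R r C) i
    f∈restrict i with f0≢fi , e ← fits zero (suc i) (λ ()) =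
      subst (f (suc i) ∈ᵐ_) (sym (lookup-restrict (f zero) R r C i))
        (clear⁺ (f zero) _ (f (suc i)) f0≢fi (keep⁺ (lookup r i) R (lookup C i) (f (suc i)) (f∈ (suc i))
          (trans e (sym (lookup∘tabulate (b zero ∘ suc) i)))))

table : ∀ {k} → (Fin k → Fin k → Bool) → Vec (Vec Bool k) k
table b = tabulate λ i → tabulate (b i)

lookup-table : ∀ {k} (b : Fin k → Fin k → Bool) i j → lookup (lookup (table b) i) j ≡ b i j
lookup-table b i j = trans
  (cong (λ r → lookup r j) (lookup∘tabulate (λ i → tabulate (b i)) i))
  (lookup∘tabulate (b i) j)

embeds? : ∀ H G → Dec (H ↪ G)
embeds? H G = map′ sound complete
  -- The size comparison rejects an `H` that is too large before any search starts.
  (T? ((n H ≤ᵇ n G) ∧ search (table (adj G)) (triangle (adj H)) everywhere))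
  where
  everywhere = replicate (n H) (replicate (n G) true)

  M-sym : ∀ i j → lookup (lookup (table (adj G)) i) j ≡ lookup (lookup (table (adj G)) j) i
  M-sym i j = trans (lookup-table (adj G) i j) (trans (Graph.sym G i j) (sym (lookup-table (adj G) j i)))

  sound : T ((n H ≤ᵇ n G) ∧ search (table (adj G)) (triangle (adj H)) everywhere) → H ↪ G
  sound t with f , _ , fits ← search-sound (table (adj G)) M-sym (adj H) (Graph.sym H) everywhere
                                (proj₂ (Equivalence.to T-∧ t)) =
    embedding f f-inj λ {i} {j} i≢j →
      trans (sym (lookup-table (adj G) (f i) (f j))) (proj₂ (fits i j i≢j))
    where
    f-inj : Injective _≡_ _≡_ f
    f-inj {i} {j} fi≡fj with i ≟ j
    ... | yes i≡j = i≡j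
    ... | no  i≢j = contradiction fi≡fj (proj₁ (fits i j i≢j))

  complete : H ↪ G → T ((n H ≤ᵇ n G) ∧ search (table (adj G)) (triangle (adj H)) everywhere)
  complete (↪⁺ (f , f-inj , f-adj)) = Equivalence.from T-∧
    ( ℕ.≤⇒≤ᵇ (injective⇒≤ f-inj)
    , search-complete (table (adj G)) M-sym (adj H) everywhere f
        ( (λ i → subst (λ c → f i ∈ᵐ c) (sym (lookup-replicate i (replicate (n G) true)))
                   (subst T (sym (lookup-replicate (f i) true)) tt))
        , λ i j i≢j → i≢j ∘ f-inj , trans (lookup-table (adj G) (f i) (f j)) (f-adj i j)))

≃? : ∀ G H → Dec (G ≃ H)
≃? G H = map′ (λ (e , G⊆H) → ↪-sameSize⇒≃ e G⊆H) (λ G≃H → ≃⇒sameSize G≃H , ≃⇒↪ G≃H)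
  ((n G ℕ.≟ n H) ×-dec embeds? G H)

lookup-with : ∀ {X R : Set} {P Q : X → Set} {xs} → All P xs → Any Q xs → (∀ {x} → P x → Q x → R) → R
lookup-with ps q f = All.lookupWith f ps q

at : ∀ {X : Set} {Q : X → Set} xs i → Q (List.lookup xs i) → Any Q xs
at xs i = lose (∈-lookup i)

-- Settled pairs

data Test : Set where
  anything     : Test
  within above : List Graph → Test

Passes : Graph → Test → Set
Passes A anything    = ⊤
Passes A (within Us) = Any (A ↪_) Us
Passes A (above Vs)  = Any (_↪ A) Vs

passes? : ∀ A t → Dec (Passes A t)
passes? A anything    = yes tt
passes? A (within Us) = Any.any? (embeds? A) Us
passes? A (above Vs)  = Any.any? (λ V → embeds? V A) Vs

passes-≃ : ∀ {A A′} → A ≃ A′ → ∀ t → Passes A t → Passes A′ t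
passes-≃ A≃A′ anything    _ = tt
passes-≃ A≃A′ (within Us) p = Any.map (↪-trans (≃⇒↪ (≃-sym A≃A′))) p
passes-≃ A≃A′ (above Vs)  p = Any.map (λ V↪A → ↪-trans V↪A (≃⇒↪ A≃A′)) p

Clause : Set
Clause = Test × Test

obstructions : List Graph
obstructions = 2 · P1 ⊕ 2 · P2 ∷ 2 · P1 ⊕ P4 ∷ 4 · P1 ⊕ P2 ∷ 3 · P2 ∷ 2 · P3 ∷ []

-- The second test is applied to the complement of H₂.  Conditions (a2), (b1) and (b2) are
-- not of this form and are absent; (a1) contributes two clauses, as P₄ is self-complementary.
clauses : List Clause
clauses =
    (within [ P4 ] , anything)
  ∷ (anything , within [ P4 ])
  ∷ (within [ P1 ⊕ P3 ] , within (K13 ⊕ 3 · P1 ∷ K13 ⊕ P2 ∷ P1 ⊕ S 1 1 2 ∷ P6 ∷ S 1 1 3 ∷ []))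
  ∷ (within [ 2 · P1 ⊕ P2 ] , within (2 · P1 ⊕ P3 ∷ 3 · P1 ⊕ P2 ∷ P2 ⊕ P3 ∷ []))
  ∷ (within [ P1 ⊕ P4 ] , within (P1 ⊕ P4 ∷ P5 ∷ []))
  ∷ (within [ 4 · P1 ] , within [ 2 · P1 ⊕ P3 ])
  ∷ (within [ K13 ] , within [ K13 ])
  ∷ (above (K13 ∷ 2 · P2 ∷ []) , above (4 · P1 ∷ 2 · P2 ∷ []))
  ∷ (above [ P1 ⊕ P4 ] , above [ P2 ⊕ P4 ])
  ∷ (above [ 2 · P1 ⊕ P2 ] , above (K13 ∷ 5 · P1 ∷ P2 ⊕ P4 ∷ P6 ∷ []))
  ∷ (above [ 3 · P1 ] , above obstructions)
  ∷ (above [ 4 · P1 ] , above (P1 ⊕ P4 ∷ 3 · P1 ⊕ P2 ∷ []))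
  ∷ []

Holds : Graph → Graph → Clause → Set
Holds A B (s , t) = Passes A s × Passes B t

Core : Graph → Graph → Set
Core A B = Any (Holds A B) clauses

-- Both halves of every clause are decided once per graph, since a graph may stand in either place.
-- The table of all pairs then only combines stored decisions.
Profile : Graph → Set
Profile A = All (λ (s , t) → Dec (Passes A s) × Dec (Passes A t)) clauses

profile : ∀ A → Profile A
profile A = All.tabulate λ {(s , t)} _ → passes? A s , passes? A t

core? : ∀ {A B} → Profile A → Profile B → Dec (Core A B)
core? = go
  where
  go : ∀ {A B cs} → All (λ (s , t) → Dec (Passes A s) × Dec (Passes A t)) cs →
    All (λ (s , t) → Dec (Passes B s) × Dec (Passes B t)) cs → Dec (Any (Holds A B) cs)
  go []             []             = no λ ()
  go ((p , _) ∷ ps) ((_ , q) ∷ qs) = map′ Any.fromSum Any.toSum ((p ×-dec q) ⊎-dec go ps qs)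

decide-all : ∀ {X : Set} {Q : X → Set} {xs} → All (Dec ∘ Q) xs → Dec (All Q xs)
decide-all []       = yes []
decide-all (p ∷ ps) = map′ (λ (q , qs) → q ∷ qs) (λ { (q ∷ qs) → q , qs }) (p ×-dec decide-all ps)

-- The first seven entries of `thirteen` are those with `3 · P1`. Exchanging K₃ and the complement
-- of P₁ + P₃ turns `3 · P1` into `P1 ⊕ P3` after complementation.
pairs : List (Graph × Graph)
pairs = List.map (λ (_ , Y) → P1 ⊕ P3 , Y) (take 7 thirteen) ++ thirteen

-- Pairs are written as H₁ together with the complement of H₂. Complementing both graphs and then
-- exchanging them turns `(A , B)` into `(B , A)`, hence the second alternative.
Match : Graph × Graph → Graph × Graph → Set
Match (A , B) (X , Y) = (A ≃ X × B ≃ Y) ⊎ (A ≃ Y × B ≃ X)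

match? : ∀ p q → Dec (Match p q)
match? (A , B) (X , Y) = (≃? A X ×-dec ≃? B Y) ⊎-dec (≃? A Y ×-dec ≃? B X)

-- The class S

-- The paths and spiders containing none of the obstructions; catalogue does the same for
-- arbitrary members of S, except that sP₁ is omitted for s ≥ 5.
small : List Graph
small = P1 ∷ P2 ∷ P3 ∷ P4 ∷ P5 ∷ P6 ∷ S 1 1 1 ∷ S 1 1 2 ∷ S 1 1 3 ∷ S 1 2 2 ∷ S 1 2 3 ∷ []

catalogue : List Graph
catalogue =
    E 0 ∷ P1 ∷ 2 · P1 ∷ P2
  ∷ 3 · P1 ∷ P1 ⊕ P2 ∷ P3
  ∷ 4 · P1 ∷ 2 · P1 ⊕ P2 ∷ P1 ⊕ P3 ∷ 2 · P2 ∷ P4 ∷ K13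
  ∷ 3 · P1 ⊕ P2 ∷ 2 · P1 ⊕ P3 ∷ P1 ⊕ 2 · P2 ∷ P1 ⊕ P4 ∷ K13 ⊕ P1 ∷ P2 ⊕ P3 ∷ P5 ∷ S 1 1 2
  ∷ 3 · P1 ⊕ P3 ∷ K13 ⊕ 2 · P1 ∷ P1 ⊕ P2 ⊕ P3 ∷ P1 ⊕ P5 ∷ P1 ⊕ S 1 1 2
  ∷ P2 ⊕ P4 ∷ K13 ⊕ P2 ∷ P6 ∷ S 1 1 3 ∷ S 1 2 2
  ∷ K13 ⊕ 3 · P1 ∷ P1 ⊕ S 1 1 3 ∷ S 1 2 3
  ∷ []

-- Embeddings into long paths and spiders

P-mono : ∀ {r s} → r ≤ s → P r ↪ P s
P-mono {r} {s} r≤s = ↪⁺ ((λ i → inject≤ i r≤s) , inject≤-injective r≤s r≤s _ _ , pres)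
  where
  pres : ∀ i j → adj (P s) (inject≤ i r≤s) (inject≤ j r≤s) ≡ adj (P r) i j
  pres i j rewrite toℕ-inject≤ i r≤s | toℕ-inject≤ j r≤s = refl

-- The third leg is numbered last, so the smaller spider is induced by an initial segment of the
-- vertices.
S-mono : ∀ i j {k l} → k ≤ l → S i j k ↪ S i j l
S-mono i j {k} {l} k≤l = ↪⁺ (f , inject≤-injective _ _ _ _ , pres)
  where
  size≤ : suc (i + j + k) ≤ suc (i + j + l)
  size≤ = s≤s (ℕ.+-monoʳ-≤ (i + j) k≤l)
  f : Fin (n (S i j k)) → Fin (n (S i j l))
  f a = inject≤ a size≤
  pres : ∀ a b → adj (S i j l) (f a) (f b) ≡ adj (S i j k) a b
  pres a b rewrite toℕ-inject≤ a size≤ | toℕ-inject≤ b size≤ = refl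

-- With symbolic leg lengths, comparisons of vertex numbers do not compute; this lemma and the next
-- supply the rewrites that decide them. The offset `c` lets one inequality serve several distances.
<⇒≢ᵇ : ∀ c {i k} → i ≤ k → (i ≡ᵇ suc (c + k)) ≡ false
<⇒≢ᵇ c {k = k} z≤n       = refl
<⇒≢ᵇ c {k = suc k} (s≤s i≤k) rewrite ℕ.+-suc c k = <⇒≢ᵇ c i≤k

>⇒≢ᵇ : ∀ c {i k} → i ≤ k → (suc (c + k) ≡ᵇ i) ≡ false
>⇒≢ᵇ c {i} {k} i≤k = trans (≡ᵇ-sym (suc (c + k)) i) (<⇒≢ᵇ c i≤k)

table-≡ : ∀ {k} {f g : Fin k → Fin k → Bool} → table f ≡ table g → ∀ a b → f a b ≡ g a b
table-≡ {f = f} {g} eq a b = trans (sym (lookup-table f a b))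
  (trans (cong (λ M → lookup (lookup M a) b) eq) (lookup-table g a b))

-- Only `H` has to be concrete: once the comparisons inside `G` are rewritten, one `refl` checks all
-- pairs of vertices at once. The first table equation encodes injectivity.
embedding-by-tables : ∀ {H G} (v : Fin (n H) → Fin (n G)) →
  table (λ a b → toℕ (v a) ≡ᵇ toℕ (v b)) ≡ table (λ a b → toℕ a ≡ᵇ toℕ b) →
  table (λ a b → adj G (v a) (v b)) ≡ table (adj H) → H ↪ G
embedding-by-tables v eq-table adj-table = ↪⁺ (v , v-inj , table-≡ adj-table)
  where
  v-inj : ∀ {a b} → v a ≡ v b → a ≡ b
  v-inj {a} {b} va≡vb = toℕ-injective (ℕ.≡ᵇ⇒≡ (toℕ a) (toℕ b)
    (subst T (table-≡ eq-table a b) (ℕ.≡⇒≡ᵇ (toℕ (v a)) (toℕ (v b)) (cong toℕ va≡vb))))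

-- The concrete summand comes first, so that the sum unfolds to successors of `m`.
toℕ-↑ʳ′ : ∀ m {k} (t : Fin k) → toℕ (m ↑ʳ t) ≡ toℕ t + m
toℕ-↑ʳ′ m t = trans (toℕ-↑ʳ m t) (ℕ.+-comm m (toℕ t))

-- The first three vertices of the second leg, which starts at 2, and of the third, which starts at
-- 5 + j. They are joined only through the omitted centre.
2P3↪S : ∀ j k → 2 · P3 ↪ S 1 (3 + j) (3 + k)
2P3↪S j k = embedding-by-tables (lookup v) eq-table adj-table
  where
  v : Vec (Fin (5 + (j + (3 + k)))) 6
  v = 2F ∷ 3F ∷ 4F ∷ (5 ↑ʳ (j ↑ʳ 0F)) ∷ (5 ↑ʳ (j ↑ʳ 1F)) ∷ (5 ↑ʳ (j ↑ʳ 2F)) ∷ []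
  eq-table : table (λ a b → toℕ (lookup v a) ≡ᵇ toℕ (lookup v b)) ≡ table (λ a b → toℕ a ≡ᵇ toℕ b)
  eq-table rewrite toℕ-↑ʳ′ j {3 + k} 0F | toℕ-↑ʳ′ j {3 + k} 1F | toℕ-↑ʳ′ j {3 + k} 2F
    | ≡ᵇ-refl j | <⇒≢ᵇ 0 (ℕ.≤-refl {j}) | <⇒≢ᵇ 1 (ℕ.≤-refl {j})
    | >⇒≢ᵇ 0 (ℕ.≤-refl {j}) | >⇒≢ᵇ 1 (ℕ.≤-refl {j}) = refl
  adj-table : table (λ a b → adj (S 1 (3 + j) (3 + k)) (lookup v a) (lookup v b)) ≡ table (adj (2 · P3))
  -- If `j` is 0, the vertices 4 and 5 + j have consecutive numbers, but the latter begins a leg.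
  -- The undetermined test `0 ≡ᵇ j` therefore stands in a conjunction with `false`, which `∧-zeroʳ`
  -- removes.
  adj-table rewrite toℕ-↑ʳ′ j {3 + k} 0F | toℕ-↑ʳ′ j {3 + k} 1F | toℕ-↑ʳ′ j {3 + k} 2F
    | ≡ᵇ-refl j | <⇒≢ᵇ 0 (ℕ.≤-refl {j}) | <⇒≢ᵇ 1 (ℕ.≤-refl {j})
    | >⇒≢ᵇ 0 (ℕ.≤-refl {j}) | >⇒≢ᵇ 1 (ℕ.≤-refl {j}) | >⇒≢ᵇ 2 (ℕ.≤-refl {j}) | ∧-zeroʳ (0 ≡ᵇ j) = refl

-- The first two vertices of each leg; the legs start at 1, 3 + i and 5 + i + j.
3P2↪S : ∀ i j k → 3 · P2 ↪ S (2 + i) (2 + j) (2 + k)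
3P2↪S i j k = embedding-by-tables (lookup v) eq-table adj-table
  where
  v : Vec (Fin (3 + (i + (2 + j) + (2 + k)))) 6
  v = 1F ∷ 2F ∷ (3 ↑ʳ ((i ↑ʳ 0F) ↑ˡ (2 + k))) ∷ (3 ↑ʳ ((i ↑ʳ 1F) ↑ˡ (2 + k)))
    ∷ (3 ↑ʳ ((i + (2 + j)) ↑ʳ 0F)) ∷ (3 ↑ʳ ((i + (2 + j)) ↑ʳ 1F)) ∷ []
  eq-table : table (λ a b → toℕ (lookup v a) ≡ᵇ toℕ (lookup v b)) ≡ table (λ a b → toℕ a ≡ᵇ toℕ b)
  eq-table rewrite toℕ-↑ˡ {i + (2 + j)} (i ↑ʳ 0F) (2 + k) | toℕ-↑ˡ {i + (2 + j)} (i ↑ʳ 1F) (2 + k)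
    | toℕ-↑ʳ′ i {2 + j} 0F | toℕ-↑ʳ′ i {2 + j} 1F
    | toℕ-↑ʳ′ (i + (2 + j)) {2 + k} 0F | toℕ-↑ʳ′ (i + (2 + j)) {2 + k} 1F
    | ℕ.+-suc i (suc j) | ℕ.+-suc i j | ≡ᵇ-refl i | ≡ᵇ-refl (i + j)
    | <⇒≢ᵇ 0 (ℕ.≤-refl {i}) | >⇒≢ᵇ 0 (ℕ.≤-refl {i})
    | <⇒≢ᵇ 0 (ℕ.m≤m+n i j) | <⇒≢ᵇ 1 (ℕ.m≤m+n i j) | <⇒≢ᵇ 2 (ℕ.m≤m+n i j)
    | >⇒≢ᵇ 0 (ℕ.m≤m+n i j) | >⇒≢ᵇ 1 (ℕ.m≤m+n i j) | >⇒≢ᵇ 2 (ℕ.m≤m+n i j)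
    | <⇒≢ᵇ 0 (ℕ.≤-refl {i + j}) | >⇒≢ᵇ 0 (ℕ.≤-refl {i + j}) = refl
  adj-table : table (λ a b → adj (S (2 + i) (2 + j) (2 + k)) (lookup v a) (lookup v b)) ≡ table (adj (3 · P2))
  adj-table rewrite toℕ-↑ˡ {i + (2 + j)} (i ↑ʳ 0F) (2 + k) | toℕ-↑ˡ {i + (2 + j)} (i ↑ʳ 1F) (2 + k)
    | toℕ-↑ʳ′ i {2 + j} 0F | toℕ-↑ʳ′ i {2 + j} 1F
    | toℕ-↑ʳ′ (i + (2 + j)) {2 + k} 0F | toℕ-↑ʳ′ (i + (2 + j)) {2 + k} 1F
    | ℕ.+-suc i (suc j) | ℕ.+-suc i j | ≡ᵇ-refl i | ≡ᵇ-refl (i + j)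
    | <⇒≢ᵇ 0 (ℕ.≤-refl {i}) | >⇒≢ᵇ 0 (ℕ.≤-refl {i}) | >⇒≢ᵇ 1 (ℕ.≤-refl {i})
    | <⇒≢ᵇ 0 (ℕ.m≤m+n i j) | <⇒≢ᵇ 1 (ℕ.m≤m+n i j) | <⇒≢ᵇ 2 (ℕ.m≤m+n i j)
    | >⇒≢ᵇ 0 (ℕ.m≤m+n i j) | >⇒≢ᵇ 1 (ℕ.m≤m+n i j) | >⇒≢ᵇ 2 (ℕ.m≤m+n i j) | >⇒≢ᵇ 3 (ℕ.m≤m+n i j)
    | <⇒≢ᵇ 0 (ℕ.≤-refl {i + j}) | >⇒≢ᵇ 0 (ℕ.≤-refl {i + j}) | >⇒≢ᵇ 1 (ℕ.≤-refl {i + j})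
    | ∧-zeroʳ (0 ≡ᵇ i) | ∧-zeroʳ (i ≡ᵇ i + j) = refl

by-search : ∀ {H G} → {True (embeds? H G)} → H ↪ G
by-search {_} {_} {t} = toWitness t

-- Classification of the graphs in S

Obstructed : Graph → Set
Obstructed G = Any (_↪ G) obstructions

obstructed-mono : ∀ {G H} → G ↪ H → Obstructed G → Obstructed H
obstructed-mono G↪H = Any.map (λ X↪G → ↪-trans X↪G G↪H)

-- P₇, S₁,₁,₄ and S₁,₃,₃ contain 2P₃, and S₂,₂,₂ contains 3P₂. Every path or spider outside `small`
-- contains one of these four.
classify-component : ∀ {G} → Component G → G ∈ small ⊎ Obstructed G
classify-component (path 1 _) = inj₁ (∈-lookup (# 0))
classify-component (path 2 _) = inj₁ (∈-lookup (# 1))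
classify-component (path 3 _) = inj₁ (∈-lookup (# 2))
classify-component (path 4 _) = inj₁ (∈-lookup (# 3))
classify-component (path 5 _) = inj₁ (∈-lookup (# 4))
classify-component (path 6 _) = inj₁ (∈-lookup (# 5))
classify-component (path (suc (suc (suc (suc (suc (suc (suc r))))))) _) =
  inj₂ (at obstructions (# 4) (↪-trans by-search (P-mono (ℕ.m≤m+n 7 r))))
classify-component (spider 1 1 1 _ _ _) = inj₁ (∈-lookup (# 6))
classify-component (spider 1 1 2 _ _ _) = inj₁ (∈-lookup (# 7))
classify-component (spider 1 1 3 _ _ _) = inj₁ (∈-lookup (# 8))
classify-component (spider 1 1 (suc (suc (suc (suc k)))) _ _ _) =
  inj₂ (at obstructions (# 4) (↪-trans by-search (S-mono 1 1 (ℕ.m≤m+n 4 k))))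
classify-component (spider 1 2 1 _ _ (s≤s ()))
classify-component (spider 1 2 2 _ _ _) = inj₁ (∈-lookup (# 9))
classify-component (spider 1 2 3 _ _ _) = inj₁ (∈-lookup (# 10))
classify-component (spider 1 2 (suc (suc (suc (suc k)))) _ _ _) =
  inj₂ (at obstructions (# 4) (↪-trans by-search (S-mono 1 2 (ℕ.m≤m+n 4 k))))
classify-component (spider 1 (suc (suc (suc j))) (suc (suc (suc k))) _ _ (s≤s (s≤s (s≤s _)))) =
  inj₂ (at obstructions (# 4) (2P3↪S j k))
classify-component (spider (suc (suc i)) (suc (suc j)) (suc (suc k)) _ (s≤s (s≤s _)) (s≤s (s≤s _))) =
  inj₂ (at obstructions (# 3) (3P2↪S i j k))

data Class (G : Graph) : Set where
  obstructed : Obstructed G → Class G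
  edgeless   : ∀ s → 5 ≤ s → G ≃ s · P1 → Class G
  listed     : Any (G ≃_) catalogue → Class G

-- The decidable part of `Class` that suffices for a catalogue graph with one more component: the
-- only edgeless graph outside the catalogue that can arise is 5P₁, from 4P₁.
Placed : Graph → Set
Placed G = Any (G ≃_) (5 · P1 ∷ catalogue) ⊎ Obstructed G

placed? : ∀ G → Dec (Placed G)
placed? G = Any.any? (≃? G) (5 · P1 ∷ catalogue) ⊎-dec Any.any? (λ X → embeds? X G) obstructions

placed⇒class : ∀ {G} → Placed G → Class G
placed⇒class (inj₁ (here e))  = edgeless 5 ℕ.≤-refl e
placed⇒class (inj₁ (there l)) = listed l
placed⇒class (inj₂ o)         = obstructed o

-- Every component contains P₁, and P₂ unless it is P₁, so an obstruction in P₁ + g or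
-- P₂ + g settles most components at once; this keeps the table small.
Extensions : Graph → Set
Extensions g = Obstructed (P1 ⊕ g)
  ⊎ Placed (P1 ⊕ g) × (Obstructed (P2 ⊕ g) ⊎ All (λ c → Placed (c ⊕ g)) small)

extensions? : ∀ g → Dec (Extensions g)
extensions? g = obstructed? P1
  ⊎-dec placed? (P1 ⊕ g) ×-dec (obstructed? P2 ⊎-dec All.all? (λ c → placed? (c ⊕ g)) small)
  where
  obstructed? : ∀ c → Dec (Obstructed (c ⊕ g))
  obstructed? c = Any.any? (λ X → embeds? X (c ⊕ g)) obstructions

abstract
  catalogue-extensions : All Extensions catalogue
  catalogue-extensions = toWitness {a? = All.all? extensions? catalogue} tt

  trivial-or-edge : All (λ c → c ≃ P1 ⊎ P2 ↪ c) small
  trivial-or-edge = toWitness {a? = All.all? (λ c → ≃? c P1 ⊎-dec embeds? P2 c) small} tt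

·P1-mono : ∀ {s t} → s ≤ t → s · P1 ↪ t · P1
·P1-mono {t = zero}  z≤n = ≃⇒↪ ≃-refl
·P1-mono {t = suc t} z≤n = ↪-trans (·P1-mono (z≤n {t})) (⊕-⊇ʳ P1)
·P1-mono {suc s} {suc t} (s≤s s≤t) = ⊕-mono {P1} {s · P1} {P1} {t · P1} (≃⇒↪ ≃-refl) (·P1-mono s≤t)

class-≃ : ∀ {G H} → G ≃ H → Class H → Class G
class-≃ G≃H (obstructed o)    = obstructed (obstructed-mono (≃⇒↪ (≃-sym G≃H)) o)
class-≃ G≃H (edgeless s s≥5 e) = edgeless s s≥5 (≃-trans G≃H e)
class-≃ G≃H (listed l)        = listed (Any.map (≃-trans G≃H) l)

4P1⊕P2↪ : ∀ {c G} → P2 ↪ c → 4 · P1 ↪ G → 4 · P1 ⊕ P2 ↪ c ⊕ G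
4P1⊕P2↪ {c} {G} P2↪c 4P1↪G = ↪-trans {G = P2 ⊕ 4 · P1} by-search (⊕-mono {P2} {4 · P1} {c} {G} P2↪c 4P1↪G)

-- Obstructions persist. An edgeless graph either gains another P₁ or meets an edge, which together
-- with four of its vertices forms the obstruction 4P₁ + P₂. For catalogue graphs the finite table
-- decides.
class-⊕ : ∀ {c G} → c ∈ small → Class G → Class (c ⊕ G)
class-⊕ {c} c∈ (obstructed o) = obstructed (obstructed-mono (⊕-⊇ʳ c) o)
class-⊕ {c} {G} c∈ (edgeless s s≥5 e) = extend (All.lookup trivial-or-edge c∈)
  where
  4P1↪G : 4 · P1 ↪ G
  4P1↪G = ↪-trans (·P1-mono {4} {s} (ℕ.≤-trans (ℕ.n≤1+n 4) s≥5)) (≃⇒↪ (≃-sym e))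
  extend : c ≃ P1 ⊎ P2 ↪ c → Class (c ⊕ G)
  extend (inj₁ c≃P1) = edgeless (suc s) (ℕ.m≤n⇒m≤1+n s≥5) (⊕-cong {c} {G} {P1} {s · P1} c≃P1 e)
  extend (inj₂ P2↪c) = obstructed (at obstructions (# 2) (4P1⊕P2↪ {c} {G} P2↪c 4P1↪G))
class-⊕ {c} {G} c∈ (listed l) = lookup-with catalogue-extensions l λ {g} x G≃g →
  class-≃ (⊕-cong {c} {G} {c} {g} ≃-refl G≃g) (extend {g} x (All.lookup trivial-or-edge c∈))
  where
  via : ∀ d g → d ↪ c → Obstructed (d ⊕ g) → Class (c ⊕ g)
  via d g d↪c o = obstructed (obstructed-mono (⊕-mono {d} {g} {c} {g} d↪c (≃⇒↪ (≃-refl {g}))) o)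
  extend : ∀ {g} → Extensions g → c ≃ P1 ⊎ P2 ↪ c → Class (c ⊕ g)
  extend {g} (inj₁ o)             (inj₁ c≃P1) = via P1 g (≃⇒↪ (≃-sym c≃P1)) o
  extend {g} (inj₁ o)             (inj₂ P2↪c) = via P1 g (↪-trans by-search P2↪c) o
  extend {g} (inj₂ (p , _))       (inj₁ c≃P1) =
    class-≃ (⊕-cong {c} {g} {P1} {g} c≃P1 ≃-refl) (placed⇒class p)
  extend {g} (inj₂ (_ , inj₁ o))  (inj₂ P2↪c) = via P2 g P2↪c o
  extend     (inj₂ (_ , inj₂ ps)) (inj₂ _)    = placed⇒class (All.lookup ps c∈)

class-unionL : ∀ {Gs} → AllComp Gs → Class (unionL Gs)
class-unionL [] = listed (here ≃-refl)
class-unionL (_∷_ {G} {Gs} c cs) with classify-component c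
... | inj₁ c∈ = class-⊕ c∈ (class-unionL cs)
... | inj₂ o  = obstructed (obstructed-mono (⊕-⊇ˡ (unionL Gs)) o)

classify : ∀ {G} → InS G → Class G
classify (Gs , cs , G≅) = class-≃ (≃⁺ G≅) (class-unionL cs)

-- Bipartiteness

-- Two-colourings combine over disjoint unions and restrict to induced subgraphs, which gives a
-- short proof that graphs in S contain no triangle.
record Bipartite (G : Graph) : Set where
  field
    colour : Fin (n G) → Bool
    proper : ∀ i j → adj G i j ≡ true → colour i ≡ not (colour j)
open Bipartite

bipartite-↪ : ∀ {H G} → H ↪ G → Bipartite G → Bipartite H
bipartite-↪ (↪⁺ (f , _ , f-adj)) b .colour = colour b ∘ f
bipartite-↪ (↪⁺ (f , _ , f-adj)) b .proper i j ij = proper b (f i) (f j) (trans (f-adj i j) ij)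

K3-not-bipartite : ¬ Bipartite (K 3)
K3-not-bipartite b = impossible (colour b 0F) _ _ (proper b 0F 1F refl) (proper b 1F 2F refl) (proper b 0F 2F refl)
  where
  impossible : ∀ x y z → x ≡ not y → y ≡ not z → x ≢ not z
  impossible true  false true  _ _ ()
  impossible false true  false _ _ ()

mk-bipartite : ∀ m (r : Fin m → Fin m → Bool) (c : Fin m → Bool) →
  (∀ i j → r i j ≡ true → c i ≡ not (c j)) → Bipartite (mk m r)
mk-bipartite m r c c-proper .colour = c
mk-bipartite m r c c-proper .proper i j ij with toℕ i ≡ᵇ toℕ j | r i j in rij | r j i in rji
... | false | true  | _    = c-proper i j rij
... | false | false | true = trans (sym (not-involutive (c i))) (cong not (sym (c-proper j i rji)))

≡ᵇ-true⇒≡ : ∀ m k → (m ≡ᵇ k) ≡ true → m ≡ k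
≡ᵇ-true⇒≡ m k e = ℕ.≡ᵇ⇒≡ m k (subst T (sym e) _)

P-bipartite : ∀ r → Bipartite (P r)
P-bipartite r = mk-bipartite r _ (parity ∘ toℕ) λ i j e →
  trans (sym (not-involutive _)) (cong (not ∘ parity) (≡ᵇ-true⇒≡ (suc (toℕ i)) (toℕ j) e))
  where
  parity : ℕ → Bool
  parity zero    = false
  parity (suc a) = not (parity a)

S-bipartite : ∀ i j k → Bipartite (S i j k)
S-bipartite i j k = mk-bipartite _ _ (c ∘ toℕ) λ a b → c-proper (toℕ a) (toℕ b)
  where
  c : ℕ → Bool
  -- The colour alternates along the numbering, except that the first vertices of the second and
  -- third legs are set to `true`, opposite to the centre.
  c zero    = false
  c (suc a) = ((suc a ≡ᵇ suc i) ∨ (suc a ≡ᵇ suc (i + j))) ∨ not (c a)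

  c-proper : ∀ a b →
    ((suc a ≡ᵇ b) ∧ not (b ≡ᵇ suc i) ∧ not (b ≡ᵇ suc (i + j)))
      ∨ ((a ≡ᵇ 0) ∧ ((b ≡ᵇ suc i) ∨ (b ≡ᵇ suc (i + j)))) ≡ true →
    c a ≡ not (c b)
  c-proper zero    zero    ()
  c-proper (suc a) zero    ()
  c-proper a (suc b) e with a ≡ᵇ b in ab | b ≡ᵇ i | b ≡ᵇ i + j
  c-proper a (suc b) e | true | false | false rewrite ≡ᵇ-true⇒≡ a b ab = sym (not-involutive (c b))
  c-proper zero (suc b) e | _ | true  | _    = refl
  c-proper zero (suc b) e | _ | false | true = refl
  c-proper (suc a) (suc b) () | false | false | false
  c-proper (suc a) (suc b) () | false | true  | _
  c-proper (suc a) (suc b) () | true  | true  | _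
  c-proper (suc a) (suc b) () | false | false | true
  c-proper (suc a) (suc b) () | true  | false | true

⊕-bipartite : ∀ {G H} → Bipartite G → Bipartite H → Bipartite (G ⊕ H)
⊕-bipartite {G} {H} g h = mk-bipartite _ _ (c ∘ splitAt (n G)) λ i j →
  c-proper (splitAt (n G) i) (splitAt (n G) j)
  where
  c : Fin (n G) ⊎ Fin (n H) → Bool
  c = Sum.[ colour g , colour h ]
  c-proper : ∀ x y → unionAdj (adj G) (adj H) x y ≡ true → c x ≡ not (c y)
  c-proper (inj₁ i) (inj₁ j) e = proper g i j e
  c-proper (inj₂ i) (inj₂ j) e = proper h i j e

unionL-bipartite : ∀ {Gs} → AllComp Gs → Bipartite (unionL Gs)
unionL-bipartite [] .colour ()
unionL-bipartite (path r _ ∷ cs) = ⊕-bipartite (P-bipartite r) (unionL-bipartite cs)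
unionL-bipartite (spider i j k _ _ _ ∷ cs) = ⊕-bipartite (S-bipartite i j k) (unionL-bipartite cs)

InS⇒bipartite : ∀ {G} → InS G → Bipartite G
InS⇒bipartite (Gs , cs , G≅) = bipartite-↪ (≃⇒↪ (≃⁺ G≅)) (unionL-bipartite cs)

-- Edgeless graphs

Edgeless : Graph → Set
Edgeless G = ∀ i j → adj G i j ≡ false

E-edgeless : ∀ m → Edgeless (E m)
E-edgeless m i j = ∧-zeroʳ _

·P1-edgeless : ∀ s → Edgeless (s · P1)
·P1-edgeless zero    ()
·P1-edgeless (suc s) i j = trans (⊕-adj P1 (s · P1) i j) (edgeless⊎ (splitAt 1 i) (splitAt 1 j))
  where
  edgeless⊎ : ∀ x y → unionAdj (adj P1) (adj (s · P1)) x y ≡ false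
  edgeless⊎ (inj₁ 0F) (inj₁ 0F) = refl
  edgeless⊎ (inj₁ _)  (inj₂ _)  = refl
  edgeless⊎ (inj₂ _)  (inj₁ _)  = refl
  edgeless⊎ (inj₂ i)  (inj₂ j)  = ·P1-edgeless s i j

edgeless-P2-free : ∀ G → Edgeless G → ¬ P2 ↪ G
edgeless-P2-free G G-edgeless (↪⁺ (f , _ , f-adj))
  with () ← trans (sym (f-adj 0F 1F)) (G-edgeless (f 0F) (f 1F))

edgeless⇒≃E : ∀ G {m} → n G ≡ m → Edgeless G → G ≃ E m
edgeless⇒≃E G refl G-edgeless = ↪-sameSize⇒≃ refl
  (↪⁺ (id , id , λ i j → trans (E-edgeless (n G) i j) (sym (G-edgeless i j))))

·P1-size : ∀ s → n (s · P1) ≡ s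
·P1-size zero    = refl
·P1-size (suc s) = cong suc (·P1-size s)

-- Links the two forms of the edgeless graph: `s · P1` comes from decompositions into components,
-- while `K s` is by definition the complement of `E s`.
·P1≃E : ∀ s → s · P1 ≃ E s
·P1≃E s = edgeless⇒≃E (s · P1) (·P1-size s) (·P1-edgeless s)

-- The settling conditions as clauses

core-≃ : ∀ {A B A′ B′} → A ≃ A′ → B ≃ B′ → Core A B → Core A′ B′
core-≃ A≃A′ B≃B′ = Any.map λ {(s , t)} → Product.map (passes-≃ A≃A′ s) (passes-≃ B≃B′ t)

clause : ∀ {A B} i → Holds A B (List.lookup clauses i) → Core A B
clause = at clauses

pattern a1 x = inj₁ x
pattern a2 x = inj₂ (inj₁ x)
pattern a3 x = inj₂ (inj₂ (inj₁ x))
pattern a4 x = inj₂ (inj₂ (inj₂ (inj₁ x)))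
pattern a5 x = inj₂ (inj₂ (inj₂ (inj₂ (inj₁ x))))
pattern a6 x = inj₂ (inj₂ (inj₂ (inj₂ (inj₂ (inj₁ x)))))
pattern a7 x = inj₂ (inj₂ (inj₂ (inj₂ (inj₂ (inj₂ (inj₁ x))))))
pattern b≥1 x = inj₂ (inj₂ (inj₂ (inj₂ (inj₂ (inj₂ (inj₂ x))))))
pattern b1 x = b≥1 (inj₁ x)
pattern b2 x = b≥1 (inj₂ (inj₁ x))
pattern b3 x = b≥1 (inj₂ (inj₂ (inj₁ x)))
pattern b4 x = b≥1 (inj₂ (inj₂ (inj₂ (inj₁ x))))
pattern b5 x = b≥1 (inj₂ (inj₂ (inj₂ (inj₂ (inj₁ x)))))
pattern b6 x = b≥1 (inj₂ (inj₂ (inj₂ (inj₂ (inj₂ (inj₁ x))))))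
pattern b7 x = b≥1 (inj₂ (inj₂ (inj₂ (inj₂ (inj₂ (inj₂ x))))))

co-P4↪P4 : co P4 ↪ P4
co-P4↪P4 = by-search

co-↪P4 : ∀ {H} → H ↪ P4 → co H ↪ P4
co-↪P4 H↪P4 = ↪-trans (co-mono H↪P4) co-P4↪P4

co-↪P4⁻ : ∀ {H} → co H ↪ P4 → H ↪ P4
co-↪P4⁻ {H} coH↪P4 = ↪-trans (≃⇒↪ (≃-sym (co-involutive H))) (co-↪P4 coH↪P4)

core⇒settled : ∀ {H₁ H₂} → Core H₁ (co H₂) → SettledOrd H₁ H₂
core⇒settled {H₁} {H₂} c = lookup-with by-clause c λ f → f
  where
  by-clause : All (λ c → Holds H₁ (co H₂) c → SettledOrd H₁ H₂) clauses
  by-clause =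
      (λ { (here p , _) → a1 (inj₁ (↪⁻ p)) })
    ∷ (λ { (_ , here q) → a1 (inj₂ (↪⁻ (co-↪P4⁻ {H₂} q))) })
    ∷ (λ { (here p , q) → a3 (↪⁻ p , Any.map ↪⁻ q) })
    ∷ (λ { (here p , q) → a4 (↪⁻ p , Any.map ↪⁻ q) })
    ∷ (λ { (here p , q) → a5 (↪⁻ p , Any.map ↪⁻ q) })
    ∷ (λ { (here p , here q) → a6 (↪⁻ p , ↪⁻ q) })
    ∷ (λ { (here p , here q) → a7 (↪⁻ p , ↪⁻ q) })
    ∷ (λ { (p , q) → b3 (either p , either q) })
    ∷ (λ { (here p , here q) → b4 (↪⁻ p , ↪⁻ q) })
    ∷ (λ { (here p , q) → b5 (↪⁻ p , Any.map ↪⁻ q) })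
    ∷ (λ { (here p , q) → b6 (↪⁻ p , Any.map ↪⁻ q) })
    ∷ (λ { (here p , q) → b7 (↪⁻ p , Any.map ↪⁻ q) })
    ∷ []
    where
    either : ∀ {X Y G} → Any (_↪ G) (X ∷ Y ∷ []) → X ⊆i G ⊎ Y ⊆i G
    either (here p)         = inj₁ (↪⁻ p)
    either (there (here p)) = inj₂ (↪⁻ p)

-- Condition (a2) is recorded as the absence of edges in H₁ and in the complement of H₂, so that a
-- single edge refutes it; (b1) and (b2) are carried along unchanged.
settled⇒core : ∀ {H₁ H₂} → SettledOrd H₁ H₂ →
  (¬ P2 ↪ H₁ × ¬ P2 ↪ co H₂) ⊎ (¬ InS H₁ × ¬ InS H₂) ⊎ (¬ InS (co H₁) × ¬ InS (co H₂)) ⊎ Core H₁ (co H₂)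
settled⇒core (a1 (inj₁ p)) = inj₂ (inj₂ (inj₂ (clause (# 0) (here (↪⁺ p) , tt))))
settled⇒core {H₂ = H₂} (a1 (inj₂ q)) = inj₂ (inj₂ (inj₂ (clause (# 1) (tt , here (co-↪P4 {H₂} (↪⁺ q))))))
settled⇒core {H₂ = H₂} (a2 (s , t , _ , _ , H₁≅ , H₂≅)) = inj₁
  ( (λ P2↪ → edgeless-P2-free (s · P1) (·P1-edgeless s) (↪-trans P2↪ (≃⇒↪ (≃⁺ H₁≅))))
  , (λ P2↪ → edgeless-P2-free (E t) (E-edgeless t)
      (↪-trans P2↪ (≃⇒↪ (≃-trans (co-cong {H₂} {K t} (≃⁺ H₂≅)) (co-involutive (E t)))))))
settled⇒core (a3 (p , q)) = inj₂ (inj₂ (inj₂ (clause (# 2) (here (↪⁺ p) , Any.map ↪⁺ q))))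
settled⇒core (a4 (p , q)) = inj₂ (inj₂ (inj₂ (clause (# 3) (here (↪⁺ p) , Any.map ↪⁺ q))))
settled⇒core (a5 (p , q)) = inj₂ (inj₂ (inj₂ (clause (# 4) (here (↪⁺ p) , Any.map ↪⁺ q))))
settled⇒core (a6 (p , q)) = inj₂ (inj₂ (inj₂ (clause (# 5) (here (↪⁺ p) , here (↪⁺ q)))))
settled⇒core (a7 (p , q)) = inj₂ (inj₂ (inj₂ (clause (# 6) (here (↪⁺ p) , here (↪⁺ q)))))
settled⇒core (b1 x)       = inj₂ (inj₁ x)
settled⇒core (b2 x)       = inj₂ (inj₂ (inj₁ x))
settled⇒core (b3 (p , q)) = inj₂ (inj₂ (inj₂ (clause (# 7) (one p , one q))))
  where
  one : ∀ {X Y G} → X ⊆i G ⊎ Y ⊆i G → Any (_↪ G) (X ∷ Y ∷ [])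
  one (inj₁ p) = here (↪⁺ p)
  one (inj₂ p) = there (here (↪⁺ p))
settled⇒core (b4 (p , q)) = inj₂ (inj₂ (inj₂ (clause (# 8) (here (↪⁺ p) , here (↪⁺ q)))))
settled⇒core (b5 (p , q)) = inj₂ (inj₂ (inj₂ (clause (# 9) (here (↪⁺ p) , Any.map ↪⁺ q))))
settled⇒core (b6 (p , q)) = inj₂ (inj₂ (inj₂ (clause (# 10) (here (↪⁺ p) , Any.map ↪⁺ q))))
settled⇒core (b7 (p , q)) = inj₂ (inj₂ (inj₂ (clause (# 11) (here (↪⁺ p) , Any.map ↪⁺ q))))

-- Open pairs

-- The second alternative reads the pair in the other order. Together with the two alternatives of
-- `Match` this covers all orders and joint complements.
Open : Graph × Graph → Set
Open (H₁ , H₂) = Any (λ p → Match (H₁ , co H₂) p ⊎ Match (H₂ , co H₁) p) pairs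

open? : ∀ p → Dec (Open p)
open? (H₁ , H₂) = Any.any? (λ p → match? (H₁ , co H₂) p ⊎-dec match? (H₂ , co H₁) p) pairs

match-≃ : ∀ {A B A′ B′} → A ≃ A′ → B ≃ B′ → ∀ p → Match (A , B) p → Match (A′ , B′) p
match-≃ A≃A′ B≃B′ (X , Y) = Sum.map (Product.map move₁ move₂) (Product.map move₁ move₂)
  where
  move₁ : ∀ {Z} → _ ≃ Z → _ ≃ Z
  move₁ = ≃-trans (≃-sym A≃A′)
  move₂ : ∀ {Z} → _ ≃ Z → _ ≃ Z
  move₂ = ≃-trans (≃-sym B≃B′)

match-swap : ∀ {A B} p → Match (A , B) p → Match (B , A) p
match-swap p (inj₁ (AX , BY)) = inj₂ (BY , AX)
match-swap p (inj₂ (AY , BX)) = inj₁ (BX , AY)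

-- A finite check that `pairs` is closed under replacing `Z` by `Z′` in first place. Excluding `Z`
-- from second place means that no other replacement has to be considered.
Exchangeable : Graph → Graph → Set
Exchangeable Z Z′ = All (λ (X , Y) → (Z ≃ X → Any (λ (X′ , Y′) → Z′ ≃ X′ × Y ≃ Y′) pairs) × ¬ Z ≃ Y) pairs

exchangeable? : ∀ Z Z′ → Dec (Exchangeable Z Z′)
exchangeable? Z Z′ = All.all? (λ (X , Y) →
  (≃? Z X →-dec Any.any? (λ (X′ , Y′) → ≃? Z′ X′ ×-dec ≃? Y Y′) pairs) ×-dec ¬? (≃? Z Y)) pairs

exchange : ∀ {Z Z′ W} → Exchangeable Z Z′ → Any (Match (Z , W)) pairs → Any (Match (Z′ , W)) pairs
exchange {Z} {Z′} {W} table l = lookup-with table l replace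
  where
  replace : ∀ {p} → (Z ≃ proj₁ p → Any (λ (X′ , Y′) → Z′ ≃ X′ × proj₂ p ≃ Y′) pairs) × ¬ Z ≃ proj₂ p →
    Match (Z , W) p → Any (Match (Z′ , W)) pairs
  replace (f , _)   (inj₁ (Z≃X , W≃Y)) = Any.map (λ (Z′≃X′ , Y≃Y′) → inj₁ (Z′≃X′ , ≃-trans W≃Y Y≃Y′)) (f Z≃X)
  replace (_ , ¬ZY) (inj₂ (Z≃Y , _))   = contradiction Z≃Y ¬ZY

abstract
  -- K₃ and the paw, which is the complement of P₁ + P₃, contain a triangle, while all graphs in
  -- `pairs` are forests; so this table and the next hold vacuously. The last two tables exchange
  -- 3P₁ and P₁ + P₃.
  K3-paw : Exchangeable (K 3) (co (P1 ⊕ P3))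
  K3-paw = toWitness {a? = exchangeable? (K 3) (co (P1 ⊕ P3))} tt

  paw-K3 : Exchangeable (co (P1 ⊕ P3)) (K 3)
  paw-K3 = toWitness {a? = exchangeable? (co (P1 ⊕ P3)) (K 3)} tt

  coK3-copaw : Exchangeable (co (K 3)) (co (co (P1 ⊕ P3)))
  coK3-copaw = toWitness {a? = exchangeable? (co (K 3)) (co (co (P1 ⊕ P3)))} tt

  copaw-coK3 : Exchangeable (co (co (P1 ⊕ P3))) (co (K 3))
  copaw-coK3 = toWitness {a? = exchangeable? (co (co (P1 ⊕ P3))) (co (K 3))} tt

-- `Open` contains the first graph once as it stands and once complemented in second place, hence
-- two tables and the swaps around the second.
exchange-first : ∀ {Z Z′ B} → Exchangeable Z Z′ → Exchangeable (co Z) (co Z′) →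
  Open (Z , B) → Open (Z′ , B)
exchange-first t t′ o = Any-⊎⁺ (Sum.map (exchange t)
  (Any.map (λ {p} → match-swap p) ∘ exchange t′ ∘ Any.map (λ {p} → match-swap p)) (Any-⊎⁻ o))

open-step : ∀ {p q} → Step p q → Open p → Open q
open-step swap = Any.map Sum.swap
open-step {A , B} {C , D} (iso A≅C B≅D) = Any.map λ {p} → Sum.map
  (match-≃ (≃⁺ A≅C) (co-cong {B} {D} (≃⁺ B≅D)) p) (match-≃ (≃⁺ B≅D) (co-cong {A} {C} (≃⁺ A≅C)) p)
-- Complementation interchanges the two alternatives of `Open` and, within each, the two
-- alternatives of `Match`.
open-step {A , B} compl = Any.map λ {p} → Sum.swap ∘ Sum.map
  (match-≃ ≃-refl (≃-sym (co-involutive A)) p ∘ match-swap p)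
  (match-≃ ≃-refl (≃-sym (co-involutive B)) p ∘ match-swap p)
open-step K3→ = exchange-first K3-paw coK3-copaw
open-step →K3 = exchange-first paw-K3 copaw-coK3

open-equiv : ∀ {p q} → Equiv p q → Open p → Open q
open-equiv ε        o = o
open-equiv (s ◅ ss) o = open-equiv ss (open-step s o)

step-sym : ∀ {p q} → Step p q → Equiv q p
step-sym swap = swap ◅ ε
step-sym {A , B} {C , D} (iso A≅C B≅D) = iso (≃⁻ (≃-sym {A} {C} (≃⁺ A≅C))) (≃⁻ (≃-sym {B} {D} (≃⁺ B≅D))) ◅ ε
-- Complementing twice restores the graphs only up to isomorphism.
step-sym {A , B} compl = compl ◅ iso (≃⁻ (co-involutive A)) (≃⁻ (co-involutive B)) ◅ ε
step-sym K3→ = →K3 ◅ ε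
step-sym →K3 = K3→ ◅ ε

equiv-sym : ∀ {p q} → Equiv p q → Equiv q p
equiv-sym ε        = ε
equiv-sym (s ◅ ss) = equiv-sym ss ◅◅ step-sym s

-- Open pairs are not settled

inS-≃ : ∀ {G H} → G ≃ H → InS H → InS G
inS-≃ {G} {H} G≃H (Gs , cs , H≅) = Gs , cs , ≃⁻ (≃-trans {G} {H} {unionL Gs} G≃H (≃⁺ H≅))

-- Explicit component lists for all graphs occurring in `pairs`: their membership in S is found by
-- deciding isomorphism with one of these unions.
decompositions : List (Σ (List Graph) AllComp)
decompositions =
    (_ , p 1 ∷ p 1 ∷ p 1 ∷ [])
  ∷ (_ , p 1 ∷ p 3 ∷ [])
  ∷ (_ , p 1 ∷ p 1 ∷ p 2 ∷ [])
  ∷ (_ , p 1 ∷ p 4 ∷ [])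
  ∷ (_ , p 1 ∷ p 1 ∷ p 3 ∷ [])
  ∷ (_ , p 1 ∷ p 2 ∷ p 3 ∷ [])
  ∷ (_ , p 1 ∷ p 2 ∷ p 2 ∷ [])
  ∷ (_ , p 1 ∷ p 5 ∷ [])
  ∷ (_ , p 1 ∷ spider 1 1 3 (s≤s z≤n) (s≤s z≤n) (s≤s z≤n) ∷ [])
  ∷ (_ , p 2 ∷ p 4 ∷ [])
  ∷ (_ , p 2 ∷ p 3 ∷ [])
  ∷ (_ , spider 1 2 2 (s≤s z≤n) (s≤s z≤n) (s≤s (s≤s z≤n)) ∷ [])
  ∷ (_ , spider 1 2 3 (s≤s z≤n) (s≤s z≤n) (s≤s (s≤s z≤n)) ∷ [])
  ∷ []
  where
  p : ∀ r .{{_ : ℕ.NonZero r}} → Component (P r)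
  p r = path r (ℕ.>-nonZero⁻¹ r)

Decomposes : Graph → Set
Decomposes G = Any (λ D → G ≃ unionL (proj₁ D)) decompositions

decomposes? : ∀ G → Dec (Decomposes G)
decomposes? G = Any.any? (λ D → ≃? G (unionL (proj₁ D))) decompositions

decomposes⇒InS : ∀ {G} → Decomposes G → InS G
decomposes⇒InS {G} l with Any.satisfied l
... | (Gs , cs) , G≃ = Gs , cs , ≃⁻ {G} {unionL Gs} G≃

NoCore : Graph → Graph → Set
NoCore X Y = ¬ Core X Y × ¬ Core Y X

noCore? : ∀ {X Y} → Profile X → Profile Y → Dec (NoCore X Y)
noCore? p q = ¬? (core? p q) ×-dec ¬? (core? q p)

-- Each field refutes one alternative of `settled⇒core`. As (b1) and (b2) require two
-- non-memberships, one membership refutes each; `co Y` stands for H₂.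
record Unsettled (X Y : Graph) : Set where
  field
    no-core  : ¬ Core X Y
    has-edge : P2 ↪ X ⊎ P2 ↪ Y
    inS      : InS X ⊎ InS (co Y)
    co-inS   : InS (co X) ⊎ InS Y

unsettled : ∀ {H₁ H₂ X Y} → Unsettled X Y → H₁ ≃ X → co H₂ ≃ Y → ¬ SettledOrd H₁ H₂
unsettled {H₁} {H₂} {X} {Y} u H₁≃X coH₂≃Y = refute ∘ settled⇒core {H₁} {H₂}
  where
  open Unsettled u
  refute : ¬ ((¬ P2 ↪ H₁ × ¬ P2 ↪ co H₂) ⊎ (¬ InS H₁ × ¬ InS H₂)
    ⊎ (¬ InS (co H₁) × ¬ InS (co H₂)) ⊎ Core H₁ (co H₂))
  refute (inj₁ (no₁ , no₂)) =
    Sum.[ (λ e → no₁ (↪-trans e (≃⇒↪ (≃-sym H₁≃X)))) , (λ e → no₂ (↪-trans e (≃⇒↪ (≃-sym coH₂≃Y)))) ] has-edge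
  refute (inj₂ (inj₁ (no₁ , no₂))) =
    Sum.[ no₁ ∘ inS-≃ H₁≃X , no₂ ∘ inS-≃ (co-flip {H₂} {Y} coH₂≃Y) ] inS
  refute (inj₂ (inj₂ (inj₁ (no₁ , no₂)))) =
    Sum.[ no₁ ∘ inS-≃ (co-cong {H₁} {X} H₁≃X) , no₂ ∘ inS-≃ coH₂≃Y ] co-inS
  refute (inj₂ (inj₂ (inj₂ c))) = no-core (core-≃ H₁≃X coH₂≃Y c)

-- If H₁ and the complement of H₂ are `X` and `Y`, then the other order of the pair is described by
-- `co Y` and `co X`; hence the requirements on complements.
Check : Graph × Graph → Set
Check (X , Y) = NoCore X Y × NoCore (co X) (co Y) × P2 ↪ Y × P2 ↪ co X × P2 ↪ co Y × Decomposes X × Decomposes Y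

check? : ∀ p → Dec (Check p)
check? (X , Y) = noCore? (profile X) (profile Y) ×-dec noCore? (profile (co X)) (profile (co Y))
  ×-dec embeds? P2 Y ×-dec embeds? P2 (co X) ×-dec embeds? P2 (co Y) ×-dec decomposes? X ×-dec decomposes? Y

abstract
  checks : All Check pairs
  checks = toWitness {a? = All.all? check? pairs} tt

match⇒unsettled : ∀ {H₁ H₂} p → Check p → Match (H₁ , co H₂) p → ¬ Settled H₁ H₂
match⇒unsettled {H₁} {H₂} (X , Y)
  ((no-XY , no-YX) , (no-coXY , no-coYX) , edgeY , edgecoX , edgecoY , dX , dY) = λ where
    (inj₁ (H₁≃X , coH₂≃Y)) → Sum.[ unsettled {H₁} {H₂} XY H₁≃X coH₂≃Y ,
      unsettled {H₂} {H₁} coYX (co-flip {H₂} {Y} coH₂≃Y) (co-cong {H₁} {X} H₁≃X) ]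
    (inj₂ (H₁≃Y , coH₂≃X)) → Sum.[ unsettled {H₁} {H₂} YX H₁≃Y coH₂≃X ,
      unsettled {H₂} {H₁} coXY (co-flip {H₂} {X} coH₂≃X) (co-cong {H₁} {Y} H₁≃Y) ]
  where
  inS-X = decomposes⇒InS {X} dX
  inS-Y = decomposes⇒InS {Y} dY
  inS-cocoX = inS-≃ (co-involutive X) inS-X
  inS-cocoY = inS-≃ (co-involutive Y) inS-Y

  XY : Unsettled X Y
  XY = record { no-core = no-XY ; has-edge = inj₂ edgeY ; inS = inj₁ inS-X ; co-inS = inj₂ inS-Y }
  YX : Unsettled Y X
  YX = record { no-core = no-YX ; has-edge = inj₁ edgeY ; inS = inj₁ inS-Y ; co-inS = inj₂ inS-X }
  coXY : Unsettled (co X) (co Y)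
  coXY = record { no-core = no-coXY ; has-edge = inj₁ edgecoX ; inS = inj₂ inS-cocoY ; co-inS = inj₁ inS-cocoX }
  coYX : Unsettled (co Y) (co X)
  coYX = record { no-core = no-coYX ; has-edge = inj₁ edgecoY ; inS = inj₂ inS-cocoX ; co-inS = inj₁ inS-cocoY }

open⇒unsettled : ∀ {H₁ H₂} → Open (H₁ , H₂) → ¬ Settled H₁ H₂
open⇒unsettled {H₁} {H₂} o s = lookup-with checks o λ {p} c →
  Sum.[ (λ m → match⇒unsettled {H₁} {H₂} p c m s) , (λ m → match⇒unsettled {H₂} {H₁} p c m (Sum.swap s)) ]

-- Reduction of the twenty pairs to the thirteen

match⇒equiv : ∀ {H₁ H₂ X Y} → Match (H₁ , co H₂) (X , Y) → Equiv (H₁ , H₂) (X , co Y)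
match⇒equiv {H₁} {H₂} {X} {Y} (inj₁ (H₁≃X , coH₂≃Y)) = iso (≃⁻ H₁≃X) (≃⁻ (co-flip {H₂} {Y} coH₂≃Y)) ◅ ε
match⇒equiv {H₁} {H₂} {X} {Y} (inj₂ (H₁≃Y , coH₂≃X)) =
  compl ◅ swap ◅ iso (≃⁻ coH₂≃X) (≃⁻ (co-cong {H₁} {Y} H₁≃Y)) ◅ ε

_↝_ : Graph × Graph → Graph × Graph → Set
(X , Y) ↝ (X′ , Y′) = (X ≃ X′ ⊎ X ≃ P1 ⊕ P3 × X′ ≃ 3 · P1) × Y ≃ Y′

_↝?_ : ∀ p q → Dec (p ↝ q)
(X , Y) ↝? (X′ , Y′) = (≃? X X′ ⊎-dec (≃? X (P1 ⊕ P3) ×-dec ≃? X′ (3 · P1))) ×-dec ≃? Y Y′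

abstract
  reduces-to-thirteen : All (λ p → Any (p ↝_) thirteen) pairs
  reduces-to-thirteen = toWitness {a? = All.all? (λ p → Any.any? (p ↝?_) thirteen) pairs} tt

  coK3≃3P1 : co (K 3) ≃ 3 · P1
  coK3≃3P1 = toWitness {a? = ≃? (co (K 3)) (3 · P1)} tt

-- In the second case the exchange applies only after complementation: P₁ + P₃ becomes the paw, is
-- replaced by K₃, and complementing back gives 3P₁.
↝⇒equiv : ∀ {X Y X′ Y′} → (X , Y) ↝ (X′ , Y′) → Equiv (X , co Y) (X′ , co Y′)
↝⇒equiv {X} {Y} {X′} {Y′} (inj₁ X≃X′ , Y≃Y′) = iso (≃⁻ X≃X′) (≃⁻ (co-cong {Y} {Y′} Y≃Y′)) ◅ ε
↝⇒equiv {X} {Y} {X′} {Y′} (inj₂ (X≃P1⊕P3 , X′≃3P1) , Y≃Y′) =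
    compl
  ◅ iso {D = co (co Y)} (≃⁻ (co-cong {X} {P1 ⊕ P3} X≃P1⊕P3)) (≃⁻ (≃-refl {co (co Y)}))
  ◅ →K3
  ◅ compl
  ◅ iso (≃⁻ (≃-trans coK3≃3P1 (≃-sym X′≃3P1)))
        (≃⁻ (≃-trans {co (co (co Y))} (co-involutive (co Y)) (co-cong {Y} {Y′} Y≃Y′)))
  ◅ ε

open⇒thirteen : ∀ {H₁ H₂} → Open (H₁ , H₂) → EquivToThirteen H₁ H₂
open⇒thirteen {H₁} {H₂} o = lookup-with reduces-to-thirteen o λ {p} l m →
  Any.map (λ r → to-pair p m ◅◅ ↝⇒equiv r) l
  where
  to-pair : ∀ p → Match (H₁ , co H₂) p ⊎ Match (H₂ , co H₁) p → Equiv (H₁ , H₂) (proj₁ p , co (proj₂ p))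
  to-pair p (inj₁ m) = match⇒equiv {H₁} {H₂} m
  to-pair p (inj₂ m) = swap ◅ match⇒equiv {H₂} {H₁} m

thirteen-open : All (λ (X , Y) → Open (X , co Y)) thirteen
thirteen-open = All.tabulate λ {(X , Y)} p∈ →
  lose (∈-++⁺ʳ (List.map (λ (_ , Y) → P1 ⊕ P3 , Y) (take 7 thirteen)) p∈) (inj₁ (inj₁ (≃-refl , co-involutive Y)))

thirteen⇒open : ∀ {H₁ H₂} → EquivToThirteen H₁ H₂ → Open (H₁ , H₂)
thirteen⇒open l = lookup-with thirteen-open l λ o e → open-equiv (equiv-sym e) o

-- Case analysis

Resolved : Graph → Graph → Set
Resolved A B = Core A B ⊎ Core B A ⊎ Any (Match (A , B)) pairs

resolved? : ∀ {A B} → Profile A → Profile B → Dec (Resolved A B)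
resolved? {A} {B} p q = core? p q ⊎-dec core? q p ⊎-dec Any.any? (match? (A , B)) pairs

table? : ∀ {as} → All Profile as → Dec (All (λ a → All (Resolved a) as) as)
table? ps = decide-all (All.map (λ p → decide-all (All.map (resolved? p) ps)) ps)

-- Against a graph containing an obstruction, the three alternatives are settled by (b6), (a1) and
-- (b3) respectively. If the graph and its complement both lie in S, only the middle alternative is
-- possible.
Trichotomy : Graph → Set
Trichotomy G = 3 · P1 ↪ G ⊎ G ↪ P4 ⊎ G ≃ 2 · P2

trichotomy? : ∀ G → Dec (Trichotomy G)
trichotomy? G = embeds? (3 · P1) G ⊎-dec embeds? G P4 ⊎-dec ≃? G (2 · P2)

trichotomy-≃ : ∀ {G H} → G ≃ H → Trichotomy H → Trichotomy G
trichotomy-≃ G≃H = Sum.map (λ p → ↪-trans p (≃⇒↪ (≃-sym G≃H))) (Sum.map (↪-trans (≃⇒↪ G≃H)) (≃-trans G≃H))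

Large : Graph → Set
Large X = 3 · P1 ↪ X × Any (_↪ X) (4 · P1 ∷ 2 · P2 ∷ [])

-- Against sP₁ with s ≥ 5, the first four alternatives lead to (a1), (b3), (b5) and (b7). For 3P₁
-- and 4P₁ condition (a2) applies directly, for P₁ + P₃ after one exchange with K₃.
SettlesEdgeless : Graph → Set
SettlesEdgeless B = B ↪ P4 ⊎ Passes B (above (K13 ∷ 2 · P2 ∷ [])) ⊎ Passes B (above [ 2 · P1 ⊕ P2 ])
  ⊎ P1 ⊕ P4 ↪ B ⊎ B ≃ 3 · P1 ⊎ B ≃ 4 · P1 ⊎ B ≃ P1 ⊕ P3

settlesEdgeless? : ∀ B → Dec (SettlesEdgeless B)
settlesEdgeless? B = embeds? B P4 ⊎-dec passes? B (above (K13 ∷ 2 · P2 ∷ [])) ⊎-dec passes? B (above [ 2 · P1 ⊕ P2 ])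
  ⊎-dec embeds? (P1 ⊕ P4) B ⊎-dec ≃? B (3 · P1) ⊎-dec ≃? B (4 · P1) ⊎-dec ≃? B (P1 ⊕ P3)

abstract
  obstructions-large : All Large obstructions
  obstructions-large = toWitness {a? = All.all?
    (λ X → embeds? (3 · P1) X ×-dec Any.any? (λ Y → embeds? Y X) (4 · P1 ∷ 2 · P2 ∷ [])) obstructions} tt

  catalogue-trichotomy : All Trichotomy catalogue
  catalogue-trichotomy = toWitness {a? = All.all? trichotomy? catalogue} tt

  catalogue-settles-edgeless : All SettlesEdgeless catalogue
  catalogue-settles-edgeless = toWitness {a? = All.all? settlesEdgeless? catalogue} tt

  catalogue-resolved : All (λ a → All (Resolved a) catalogue) catalogue
  catalogue-resolved = toWitness {a? = table? (All.tabulate {xs = catalogue} λ {a} _ → profile a)} tt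

  C4-unobstructed : ¬ Obstructed (co (2 · P2))
  C4-unobstructed = toWitness {a? = ¬? (passes? (co (2 · P2)) (above obstructions))} tt

  C4-unlisted : ¬ Any (co (2 · P2) ≃_) catalogue
  C4-unlisted = toWitness {a? = ¬? (Any.any? (≃? (co (2 · P2))) catalogue)} tt

  co-3P1 : K 3 ↪ co (3 · P1)
  co-3P1 = toWitness {a? = embeds? (K 3) (co (3 · P1))} tt

large : ∀ {G} → Obstructed G → Large G
large o = lookup-with obstructions-large o λ l X↪G →
  Product.map (λ p → ↪-trans p X↪G) (Any.map (λ p → ↪-trans p X↪G)) l

trichotomy : ∀ {G} → Class G → Trichotomy G
trichotomy (obstructed o)     = inj₁ (proj₁ (large o))
trichotomy (edgeless s s≥5 e) = inj₁ (↪-trans (·P1-mono {3} {s} (ℕ.≤-trans (ℕ.m≤m+n 3 2) s≥5)) (≃⇒↪ (≃-sym e)))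
trichotomy (listed l)         = lookup-with catalogue-trichotomy l λ t G≃g → trichotomy-≃ G≃g t

-- The complement of 2P₂ is the four-cycle. It is bipartite, so colourings cannot exclude it from S,
-- but the classification can; having four vertices, it is no sP₁ with s ≥ 5.
C4-unclassified : ¬ Class (co (2 · P2))
C4-unclassified (obstructed o)     = C4-unobstructed o
C4-unclassified (listed l)         = C4-unlisted l
C4-unclassified (edgeless s s≥5 e) =
  ℕ.<⇒≱ s≥5 (ℕ.≤-reflexive (trans (sym (·P1-size s)) (sym (≃⇒sameSize e))))

-- An induced 3P₁ would give a triangle in the complement, and 2P₂ has the four-cycle as its
-- complement; neither complement lies in S.
inS-both⇒↪P4 : ∀ {G} → InS G → InS (co G) → G ↪ P4
inS-both⇒↪P4 {G} i i′ = cases (trichotomy (classify i))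
  where
  cases : Trichotomy G → G ↪ P4
  cases (inj₁ 3P1↪G)        = contradiction
    (bipartite-↪ (↪-trans co-3P1 (co-mono {3 · P1} {G} 3P1↪G)) (InS⇒bipartite i′)) K3-not-bipartite
  cases (inj₂ (inj₁ G↪P4))  = G↪P4
  cases (inj₂ (inj₂ G≃2P2)) = contradiction
    (class-≃ (≃-sym (co-cong {G} {2 · P2} G≃2P2)) (classify i′)) C4-unclassified

-- `both-edgeless` is condition (a2), which is not among the clauses. `edgeless-copaw` is kept apart
-- because it becomes settled only after a step of equivalence.
data Outcome (A B : Graph) : Set where
  core           : Core A B → Outcome A B
  matches        : Any (Match (A , B)) pairs → Outcome A B
  both-edgeless  : ∀ s t → 1 ≤ s → 1 ≤ t → A ≃ s · P1 → B ≃ t · P1 → Outcome A B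
  edgeless-copaw : ∀ s → 1 ≤ s → A ≃ s · P1 → B ≃ P1 ⊕ P3 → Outcome A B

outcome-≃ : ∀ {A B B′} → B ≃ B′ → Outcome A B → Outcome A B′
outcome-≃ B≃B′ (core c) = core (core-≃ ≃-refl B≃B′ c)
outcome-≃ B≃B′ (matches l) = matches (Any.map (λ {p} → match-≃ ≃-refl B≃B′ p) l)
outcome-≃ B≃B′ (both-edgeless s t s≥1 t≥1 A≃ B≃) = both-edgeless s t s≥1 t≥1 A≃ (≃-trans (≃-sym B≃B′) B≃)
outcome-≃ B≃B′ (edgeless-copaw s s≥1 A≃ B≃) = edgeless-copaw s s≥1 A≃ (≃-trans (≃-sym B≃B′) B≃)

obstructed-core : ∀ {A B} → Obstructed A → Trichotomy B → Core B A
obstructed-core o (inj₁ 3P1↪B)        = clause (# 10) (here 3P1↪B , o)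
obstructed-core o (inj₂ (inj₁ B↪P4))  = clause (# 0) (here B↪P4 , tt)
obstructed-core o (inj₂ (inj₂ B≃2P2)) = clause (# 7) (there (here (≃⇒↪ (≃-sym B≃2P2))) , proj₂ (large o))

edgeless-listed : ∀ {A B} s → 5 ≤ s → A ≃ s · P1 → Any (B ≃_) catalogue → Outcome A B ⊎ Outcome B A
edgeless-listed {A} {B} s s≥5 A≃ l = lookup-with catalogue-settles-edgeless l cases
  where
  s≥1 : 1 ≤ s
  s≥1 = ℕ.≤-trans (ℕ.m≤m+n 1 4) s≥5

  ·P1↪A : ∀ r → r ≤ 5 → r · P1 ↪ A
  ·P1↪A r r≤5 = ↪-trans (·P1-mono {r} {s} (ℕ.≤-trans r≤5 s≥5)) (≃⇒↪ (≃-sym A≃))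

  up : ∀ {b Vs} → B ≃ b → Any (_↪ b) Vs → Any (_↪ B) Vs
  up B≃b = Any.map λ p → ↪-trans p (≃⇒↪ (≃-sym B≃b))

  cases : ∀ {b} → SettlesEdgeless b → B ≃ b → Outcome A B ⊎ Outcome B A
  cases (inj₁ b↪P4) B≃b = inj₂ (core (clause (# 0) (here (↪-trans (≃⇒↪ B≃b) b↪P4) , tt)))
  cases (inj₂ (inj₁ p)) B≃b = inj₂ (core (clause (# 7) (up B≃b p , here (·P1↪A 4 (ℕ.n≤1+n 4)))))
  cases (inj₂ (inj₂ (inj₁ p))) B≃b = inj₂ (core (clause (# 9) (up B≃b p , there (here (·P1↪A 5 ℕ.≤-refl)))))
  cases (inj₂ (inj₂ (inj₂ (inj₁ p)))) B≃b =
    inj₁ (core (clause (# 11) (here (·P1↪A 4 (ℕ.n≤1+n 4)) , up B≃b (here p))))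
  cases (inj₂ (inj₂ (inj₂ (inj₂ (inj₁ e))))) B≃b =
    inj₁ (both-edgeless s 3 s≥1 (s≤s z≤n) A≃ (≃-trans B≃b e))
  cases (inj₂ (inj₂ (inj₂ (inj₂ (inj₂ (inj₁ e)))))) B≃b =
    inj₁ (both-edgeless s 4 s≥1 (s≤s z≤n) A≃ (≃-trans B≃b e))
  cases (inj₂ (inj₂ (inj₂ (inj₂ (inj₂ (inj₂ e)))))) B≃b =
    inj₁ (edgeless-copaw s s≥1 A≃ (≃-trans B≃b e))

analyse : ∀ {A B} → Class A → Class B → Outcome A B ⊎ Outcome B A
analyse (obstructed o)     c              = inj₂ (core (obstructed-core o (trichotomy c)))
analyse c                  (obstructed o) = inj₁ (core (obstructed-core o (trichotomy c)))
analyse (edgeless s s≥5 A≃) (edgeless t t≥5 B≃) =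
  inj₁ (both-edgeless s t (ℕ.≤-trans (ℕ.m≤m+n 1 4) s≥5) (ℕ.≤-trans (ℕ.m≤m+n 1 4) t≥5) A≃ B≃)
analyse (edgeless s s≥5 A≃) (listed l) = edgeless-listed s s≥5 A≃ l
analyse (listed l) (edgeless s s≥5 B≃) = Sum.swap (edgeless-listed s s≥5 B≃ l)
analyse {A} {B} (listed k) (listed l) =
  lookup-with catalogue-resolved k λ rs A≃a → lookup-with rs l λ r B≃b → cases A≃a B≃b r
  where
  cases : ∀ {a b} → A ≃ a → B ≃ b → Resolved a b → Outcome A B ⊎ Outcome B A
  cases A≃a B≃b (inj₁ c)        = inj₁ (core (core-≃ (≃-sym A≃a) (≃-sym B≃b) c))
  cases A≃a B≃b (inj₂ (inj₁ c)) = inj₂ (core (core-≃ (≃-sym B≃b) (≃-sym A≃a) c))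
  cases A≃a B≃b (inj₂ (inj₂ m)) =
    inj₁ (matches (Any.map (λ {p} → match-≃ (≃-sym A≃a) (≃-sym B≃b) p) m))

-- Every pair that is not equivalent to a settled one is open

Decided : Graph → Graph → Set
Decided H₁ H₂ = EquivToSettled H₁ H₂ ⊎ Open (H₁ , H₂)

decided-equiv : ∀ {H₁ H₂ H₃ H₄} → Equiv (H₁ , H₂) (H₃ , H₄) → Decided H₃ H₄ → Decided H₁ H₂
decided-equiv e (inj₁ (_ , _ , s , e′)) = inj₁ (_ , _ , s , e ◅◅ e′)
decided-equiv e (inj₂ o)                = inj₂ (open-equiv (equiv-sym e) o)

conclude : ∀ {H₁ H₂} → Outcome H₁ (co H₂) → Decided H₁ H₂
conclude {H₁} {H₂} (core c) = inj₁ (H₁ , H₂ , inj₁ (core⇒settled {H₁} {H₂} c) , ε)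
conclude (matches l) = inj₂ (Any.map inj₁ l)
conclude {H₁} {H₂} (both-edgeless s t s≥1 t≥1 H₁≃ coH₂≃) =
  inj₁ (H₁ , H₂ , inj₁ (a2 (s , t , s≥1 , t≥1 , ≃⁻ H₁≃ , ≃⁻ H₂≃Kt)) , ε)
  where
  H₂≃Kt : H₂ ≃ K t
  H₂≃Kt = co-flip {H₂} {E t} (≃-trans coH₂≃ (·P1≃E t))
conclude {H₁} {H₂} (edgeless-copaw s s≥1 H₁≃ coH₂≃) =
  inj₁ (H₁ , K 3 , inj₁ (a2 (s , 3 , s≥1 , s≤s z≤n , ≃⁻ H₁≃ , ≃⁻ (≃-refl {K 3}))) ,
    -- The exchange with K₃ acts on the first graph of a pair, hence the two swaps.
    swap ◅ iso (≃⁻ (co-flip {H₂} {P1 ⊕ P3} coH₂≃)) (≃⁻ (≃-refl {H₁})) ◅ →K3 ◅ swap ◅ ε)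

decide-pair : ∀ {H₁ H₂} → InS H₁ → InS (co H₂) → Decided H₁ H₂
decide-pair {H₁} {H₂} i i′ = Sum.[ conclude , flipped ] (analyse (classify i) (classify i′))
  where
  flipped : Outcome (co H₂) H₁ → Decided H₁ H₂
  -- Complementing and exchanging the graphs makes the complement of H₂ the first graph and the
  -- double complement of H₁ the second coordinate, as `o` requires up to isomorphism.
  flipped o = decided-equiv (compl ◅ swap ◅ ε) (conclude (outcome-≃ (≃-sym (co-involutive H₁)) o))

-- Membership in S is only assumed, inside refutations. Since (b1) fails, one of the two graphs may
-- be taken in S; since (b2) fails, one of the two complements. If these belong to the same graph,
-- it embeds into P₄ and (a1) applies; otherwise `decide-pair` does.
unsettled⇒open : ∀ {H₁ H₂} → ¬ EquivToSettled H₁ H₂ → Open (H₁ , H₂)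
unsettled⇒open {H₁} {H₂} ns = decidable-stable (open? (H₁ , H₂)) λ ¬open →
  let
    settled : ¬ SettledOrd H₁ H₂
    settled s = ns (H₁ , H₂ , inj₁ s , ε)
    decided : ¬ Decided H₁ H₂
    decided = Sum.[ ns , ¬open ]
  in settled (b1
    ( (λ i₁ → settled (b2
        ( (λ j₁ → settled (a1 (inj₁ (↪⁻ (inS-both⇒↪P4 {H₁} i₁ j₁)))))
        , (λ j₂ → decided (decide-pair i₁ j₂)))))
    , (λ i₂ → settled (b2
        ( (λ j₁ → decided (decided-equiv (swap ◅ ε) (decide-pair i₂ j₁)))
        , (λ j₂ → settled (a1 (inj₂ (↪⁻ (inS-both⇒↪P4 {H₂} i₂ j₂))))))))))

theorem8 : (H₁ H₂ : Graph) → (¬ EquivToSettled H₁ H₂) ⇔ EquivToThirteen H₁ H₂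
theorem8 H₁ H₂ = mk⇔ (open⇒thirteen ∘ unsettled⇒open)
  λ e (H₃ , H₄ , s , e′) → open⇒unsettled (open-equiv e′ (thirteen⇒open e)) s
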